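{- Let $G_3(x,y,z)=\sum_{k,\ell,m\ge 0}V(1^k2^\ell3^m)\,x^ky^\ell z^m$ be the ordinary generating function of the numbers of vertices of the Gelfand--Zetlin polytopes $GZ(1^k2^\ell3^m)$. Then $$G_3(x,y,z)=\frac{2xz-y(1-x-z)-y\sqrt{1-2(x+z)+(x-z)^2}}{2(1-x-z)\bigl((x+y)(y+z)-y\bigr)}.$$
   Context: Let $\lambda_1\le\dots\le\lambda_n$ be a non-decreasing finite sequence of integers (called a partition). The Gelfand--Zetlin polytope $GZ(\lambda)$ is the convex polytope in $\mathbb{R}^{n(n-1)/2}$ with coordinates $u_{i,j}$ ($1\le i\le n-1$, $1\le j\le n-i$) defined by the inequalities $u_{i-1,j}\le u_{i,j}\le u_{i-1,j+1}$ for all such $i,j$, where $u_{0,j}:=\lambda_j$. For non-negative integers $k,\ell,m$ (some possibly zero), $1^k2^\ell3^m$ denotes the sequence consisting of $k$ copies of $1$, followed by $\ell$ copies of $2$, followed by $m$ copies of $3$. $V(p)$ denotes the number of vertices of $GZ(p)$; for the empty sequence $V=1$ (the polytope is a point). The square root denotes the formal power series in $x,z$ with constant term $1$ whose square is $1-2(x+z)+(x-z)^2$; the identity is in the field of fractions of the power series ring $\mathbb{Q}[[x,y,z]]$ (equivalently, $G_3$ times the denominator equals the numerator). -}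

module Defs where

open import Level using (Level; _⊔_) renaming (suc to lsuc)
open import Algebra.Apartness.Bundles using (HeytingField)
open import Data.Fin.Base using (Fin; toℕ; fromℕ<)
open import Data.Integer.Base using (ℤ; +_; -[1+_])
open import Data.List.Base using (List; length; lookup; replicate; _++_)
open import Data.Nat.Base as ℕ using (ℕ; zero; suc; _∸_)
import Data.Nat.Properties as ℕ
open import Data.Product.Base using (Σ; _×_; proj₁)
open import Data.Rational.Base as ℚ using (ℚ; 0ℚ; 1ℚ)
import Data.Rational.Properties as ℚ
open import Data.Sum.Base using (_⊎_)
open import Function.Bundles using (Bijection)
open import Relation.Binary.Bundles using (Setoid)
open import Relation.Binary.Core using (Rel)
open import Relation.Binary.PropositionalEquality using (_≡_; setoid; subst; sym)
open import Relation.Binary.Structures using (IsStrictPartialOrder)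
open import Relation.Nullary.Negation using (¬_)

-- The library has no real numbers, so polytopes live over an arbitrary
-- ordered field.  Comparability is expressed through apartness instead of a
-- decidable order; classically these are exactly the ordered fields, and
-- constructively both ℚ and the (Cauchy or Dedekind) reals are instances.
record OrderedField c ℓ₁ ℓ₂ ℓ₃ : Set (lsuc (c ⊔ ℓ₁ ⊔ ℓ₂ ⊔ ℓ₃)) where
  field
    heytingField : HeytingField c ℓ₁ ℓ₂

  open HeytingField heytingField public

  infix 4 _<_ _≤_

  field
    _<_                  : Rel Carrier ℓ₃
    isStrictPartialOrder : IsStrictPartialOrder _≈_ _<_
    #⇒<⊎>                : ∀ {x y} → x # y → x < y ⊎ y < x
    <⇒#                  : ∀ {x y} → x < y → x # y
    +-monoˡ-<            : ∀ z {x y} → x < y → x + z < y + z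
    *-pos                : ∀ {x y} → 0# < x → 0# < y → 0# < x * y

  _≤_ : Rel Carrier ℓ₃
  x ≤ y = ¬ (y < x)

  fromℕ : ℕ → Carrier
  fromℕ zero    = 0#
  fromℕ (suc n) = 1# + fromℕ n

  fromℤ : ℤ → Carrier
  fromℤ (+ n)    = fromℕ n
  fromℤ -[1+ n ] = - fromℕ (suc n)

module _ {c ℓ₁ ℓ₂ ℓ₃} (K : OrderedField c ℓ₁ ℓ₂ ℓ₃) where

  open OrderedField K hiding (setoid; sym)

  -- Rows are numbered as usual, columns from 0: the value at i j is u_{i+1,j+1},
  -- so the index range 1 ≤ i ≤ n - 1, 1 ≤ j ≤ n - i becomes suc i + j < n.
  Point : ℕ → Set c
  Point n = ∀ i j → .(suc i ℕ.+ j ℕ.< n) → Carrier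

  infix 4 _≈ᴾ_

  _≈ᴾ_ : ∀ {n} → Rel (Point n) ℓ₁
  _≈ᴾ_ {n} u v = ∀ i j (h : suc i ℕ.+ j ℕ.< n) → u i j h ≈ v i j h

  -- tu + (1 - t)v
  combination : ∀ {n} → Carrier → Point n → Point n → Point n
  combination t u v i j h = t * u i j h + (1# - t) * v i j h

  module _ (p : List ℤ) where

    -- entry u i j is u_{i,j+1}, where row 0 is p.
    entry : Point (length p) → ∀ i j → .(i ℕ.+ j ℕ.< length p) → Carrier
    entry u zero    j h = fromℤ (lookup p (fromℕ< h))
    entry u (suc i) j h = u i j h

    infix 4 _∈GZ

    _∈GZ : Point (length p) → Set ℓ₃
    u ∈GZ = ∀ i j (h : suc i ℕ.+ j ℕ.< length p) →
      entry u i j (ℕ.<-trans (ℕ.n<1+n (i ℕ.+ j)) h) ≤ entry u (suc i) j h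
      × entry u (suc i) j h ≤ entry u i (suc j) (subst (ℕ._< length p) (sym (ℕ.+-suc i j)) h)

    -- A vertex is an extreme point.
    IsVertex : Point (length p) → Set (c ⊔ ℓ₁ ⊔ ℓ₃)
    IsVertex v = v ∈GZ ×
      (∀ u w t → u ∈GZ → w ∈GZ → 0# < t → t < 1# →
       v ≈ᴾ combination t u w → u ≈ᴾ v × w ≈ᴾ v)

    vertexSetoid : Setoid (c ⊔ ℓ₁ ⊔ ℓ₃) ℓ₁
    vertexSetoid = record
      { Carrier       = Σ (Point (length p)) IsVertex
      ; _≈_           = λ v w → proj₁ v ≈ᴾ proj₁ w
      ; isEquivalence = record
        { refl  = λ _ _ _ → refl
        ; sym   = λ e i j h → Eq.sym (e i j h)
        ; trans = λ e f i j h → trans (e i j h) (f i j h)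
        }
      }
      where module Eq = HeytingField heytingField

    HasVertexCount : ℕ → Set (c ⊔ ℓ₁ ⊔ ℓ₃)
    HasVertexCount N = Bijection (setoid (Fin N)) vertexSetoid

1^_2^_3^_ : ℕ → ℕ → ℕ → List ℤ
1^ k 2^ l 3^ m = replicate k (+ 1) ++ replicate l (+ 2) ++ replicate m (+ 3)

-- ℚ[[x,y,z]]: f k l m is the coefficient of x^k y^l z^m.
Series : Set
Series = ℕ → ℕ → ℕ → ℚ

infix  4 _≈ˢ_
infixl 6 _+ˢ_ _-ˢ_
infixl 7 _*ˢ_

_≈ˢ_ : Rel Series _
f ≈ˢ g = ∀ k l m → f k l m ≡ g k l m

_+ˢ_ : Series → Series → Series
(f +ˢ g) k l m = f k l m ℚ.+ g k l m

_-ˢ_ : Series → Series → Series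
(f -ˢ g) k l m = f k l m ℚ.- g k l m

open import Algebra.Properties.Monoid.Sum ℚ.+-0-monoid using (sum⁺-syntax)

_*ˢ_ : Series → Series → Series
(f *ˢ g) k l m = ∑[ a ≤ k ] ∑[ b ≤ l ] ∑[ c ≤ m ]
  (f (toℕ a) (toℕ b) (toℕ c) ℚ.* g (k ∸ toℕ a) (l ∸ toℕ b) (m ∸ toℕ c))

const : ℚ → Series
const q 0 0 0 = q
const q _ _ _ = 0ℚ

X Y Z : Series
X 1 0 0 = 1ℚ
X _ _ _ = 0ℚ
Y 0 1 0 = 1ℚ
Y _ _ _ = 0ℚ
Z 0 0 1 = 1ℚ
Z _ _ _ = 0ℚ

𝟎 𝟏 𝟐 : Series
𝟎 = const 0ℚ
𝟏 = const 1ℚ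
𝟐 = const (+ 2 ℚ./ 1)

generatingFunction : (ℕ → ℕ → ℕ → ℕ) → Series
generatingFunction V k l m = + V k l m ℚ./ 1

-- s is the power series in x and z alone (no y occurs in s) with constant
-- term 1 and square f; such a series is unique.
IsSquareRoot : Series → Series → Set
IsSquareRoot s f =
  (∀ k l m → s k (suc l) m ≡ 0ℚ) × s 0 0 0 ≡ 1ℚ × s *ˢ s ≈ˢ f

-- f = num / den in the field of fractions of ℚ[[x,y,z]].
infix 4 _≈_/ˢ_

_≈_/ˢ_ : Series → Series → Series → Set
f ≈ num /ˢ den = ¬ (den ≈ˢ 𝟎) × f *ˢ den ≈ˢ num

{-# OPTIONS --safe #-}

-- Vertices.  A point x of the polytope is moved to x ± q(x)/2 by applying to all entries
-- a polynomial q, vanishing on the top row, for which both maps are increasing on [1,3];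
-- this keeps the interlacing inequalities, so at a vertex every entry is a root of q.
-- Hence the second row of a vertex is a corner of the box of rows interlacing with the
-- top row, and the vertices over a corner are those of the smaller polytope with that
-- corner as its top row.  For l ≥ 1 this gives
--   V(k,l,m) = V(k,l-1,m) + V(k-1,l,m) + V(k,l,m-1) + V(k-1,l+1,m-1),
-- with V = 0 at negative arguments.
--
-- Generating function.  Write G = Σ Gₗ yˡ with Gₗ in ℚ[[x,z]].  The binomial numbers
-- V(k,0,m) give (1-x-z) G₀ = 1.  Put T = (1-x-z) G₁.  Both T·Gₗ and Gₗ₊₁ satisfy the
-- recurrence and they agree for l = 0, so Gₗ₊₁ = T·Gₗ for all l; the recurrence for l = 1
-- becomes xz T² = (1-x-z) T - 1.  Completing the square, 1-x-z-2xzT is the required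
-- square root.

module Submission where

open import Defs
open import Algebra.Apartness.Bundles using (HeytingCommutativeRing)
open import Algebra.Bundles using (CommutativeRing; RawRing)
open import Algebra.Solver.Ring.AlmostCommutativeRing using (fromCommutativeRing; _-Raw-AlmostCommutative⟶_)
open import Data.Empty using (⊥)
open import Data.Fin.Base using (Fin; zero; suc; toℕ; fromℕ<; splitAt; _↑ˡ_; _↑ʳ_; join)
open import Data.Fin.Properties using (splitAt-↑ˡ; splitAt-↑ʳ; join-splitAt; toℕ-fromℕ<)
open import Data.Integer.Base using (ℤ; +_)
open import Data.Integer.Solver using (module +-*-Solver)
open import Data.List.Base using (List; length; lookup; replicate; _++_)
open import Data.List.Properties using (length-++; length-replicate)
open import Data.Maybe.Base using (Maybe; just; nothing)
open import Data.Nat.Base as ℕ using (ℕ; zero; suc; _∸_; s≤s; z≤n; s<s⁻¹)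
import Data.Nat.Properties as ℕ
open import Data.Product.Base using (Σ; ∃; _×_; _,_; proj₁; proj₂; map)
open import Data.Rational.Base as ℚ using (ℚ; 0ℚ; 1ℚ)
import Data.Rational.Properties as ℚ
open import Data.Rational.Unnormalised.Base as ℚᵘ using (mkℚᵘ; *≡*)
import Data.Rational.Unnormalised.Properties as ℚᵘ
open import Data.Sum.Base using (_⊎_; inj₁; inj₂; [_,_]) renaming (map to map⊎)
open import Function.Base using (_∘_; id)
open import Level using (_⊔_)
open import Relation.Binary.Bundles using (Setoid)
open import Relation.Binary.PropositionalEquality as ≡ using (_≡_; subst; cong; cong₂)
open import Relation.Binary.Structures using (IsStrictPartialOrder)
open import Relation.Nullary.Decidable.Core using (yes; no)
open import Relation.Nullary.Negation using (¬_; contradiction)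
import Algebra.Apartness.Properties.HeytingCommutativeRing
import Algebra.Properties.Ring
import Algebra.Properties.Semiring.Mult.TCOptimised
import Algebra.Solver.CommutativeMonoid
import Algebra.Solver.Ring

-- Ring solver

-- Over an arbitrary ordered field neither equality nor order is decidable, so a vertex cannot be
-- analysed by asking which of its entries are tied. The perturbation asks for no such decision: one
-- polynomial moves all entries at once, extremality yields the equation q(x) = 0, and only then
-- does apartness from fixed numbers single out a root.
--
-- Two polynomials occur: (x-1)(x-2)(x-3) when the top row contains a 2, and (x-1)(x-3) when it does
-- not, since a 1 may then stand next to a 3 and 2 must not survive as a root between them. For the
-- same reason l = 0 has a recurrence of its own. On [1,3] the difference quotients of both
-- polynomials lie in [-2,2], whence the factor 1/2.
--
-- On the side of series there is no division by y: an equation f = y g with f free of y gives f =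
-- 0, and this takes the place of setting y = 0 and of cancelling G. The geometric law for the Gₗ
-- also spares the usual step of the kernel method, substituting a root of the kernel for y, as it
-- determines G₁ directly.

reduce : ℕ × ℕ → ℕ × ℕ
reduce (suc a , suc b) = reduce (a , b)
reduce p               = p

-- The pair (a , b) stands for the integer a - b.  Results are reduced since the
-- ring solver compares coefficients of normal forms syntactically.
differences : RawRing _ _
differences = record
  { Carrier = ℕ × ℕ
  ; _≈_     = _≡_
  ; _+_     = λ (a , b) (c , d) → reduce (a ℕ.+ c , b ℕ.+ d)
  ; _*_     = λ (a , b) (c , d) → reduce (a ℕ.* c ℕ.+ b ℕ.* d , a ℕ.* d ℕ.+ b ℕ.* c)
  ; -_      = λ (a , b) → b , a
  ; 0#      = 0 , 0
  ; 1#      = 1 , 0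
  }

module IntegerCoefficients {c ℓ} (R : CommutativeRing c ℓ) where

  open CommutativeRing R hiding (zero)
  open Algebra.Properties.Semiring.Mult.TCOptimised semiring using (×-homo-+; ×1-homo-*; 1+×) renaming (_×_ to _·_)
  open Algebra.Properties.Ring ring using (-0#≈0#; -‿distribˡ-*; -‿distribʳ-*; -‿+-comm; ⁻¹-anti-homo‿-; x∙y⁻¹≈ε⇒x≈y; -‿involutive)
  open Algebra.Solver.CommutativeMonoid +-commutativeMonoid using (_⊕_; _⊜_) renaming (solve to solve⁺)
  open import Relation.Binary.Reasoning.Setoid setoid

  -- The separate clause for a zero subtrahend, with a multiple for which `1 · 1#` reduces to `1#`,
  -- makes the coefficients 0 and 1 denote `0#` and `1#` definitionally, as `0-homo` and `1-homo`
  -- use.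
  difference : ℕ × ℕ → Carrier
  difference (a , zero)  = a · 1#
  difference (a , suc b) = a · 1# - suc b · 1#

  private
    interchange : ∀ x y z w → (x + y) + (z + w) ≈ (x + z) + (y + w)
    interchange = solve⁺ 4 (λ x y z w → (x ⊕ y) ⊕ (z ⊕ w) ⊜ (x ⊕ z) ⊕ (y ⊕ w)) refl

    difference≈ : ∀ a b → difference (a , b) ≈ a · 1# - b · 1#
    difference≈ a zero    = sym (trans (+-congˡ -0#≈0#) (+-identityʳ _))
    difference≈ a (suc b) = refl

    difference-reduce : ∀ a b → difference (reduce (a , b)) ≈ a · 1# - b · 1#
    difference-reduce zero    b       = difference≈ zero b
    difference-reduce (suc a) zero    = difference≈ (suc a) zero
    difference-reduce (suc a) (suc b) = begin
      difference (reduce (a , b))               ≈⟨ difference-reduce a b ⟩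
      A - B                                     ≈⟨ +-identityˡ _ ⟨
      0# + (A - B)                              ≈⟨ +-congʳ (-‿inverseʳ 1#) ⟨
      (1# - 1#) + (A - B)                       ≈⟨ interchange _ _ _ _ ⟩
      (1# + A) + (- 1# - B)                     ≈⟨ +-congˡ (-‿+-comm 1# B) ⟩
      (1# + A) - (1# + B)                       ≈⟨ +-cong (1+× a 1#) (-‿cong (1+× b 1#)) ⟨
      suc a · 1# - suc b · 1#                   ∎
      where
      A = a · 1#
      B = b · 1#

    -x*-y≈x*y : ∀ x y → - x * - y ≈ x * y
    -x*-y≈x*y x y = begin
      - x * - y    ≈⟨ -‿distribˡ-* x (- y) ⟨
      - (x * - y)  ≈⟨ -‿cong (-‿distribʳ-* x y) ⟨
      - - (x * y)  ≈⟨ -‿involutive _ ⟩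
      x * y        ∎

    +-homo : ∀ x y → difference (RawRing._+_ differences x y) ≈ difference x + difference y
    +-homo (a , b) (c , d) = begin
      difference (reduce (a ℕ.+ c , b ℕ.+ d))       ≈⟨ difference-reduce (a ℕ.+ c) (b ℕ.+ d) ⟩
      (a ℕ.+ c) · 1# - (b ℕ.+ d) · 1#               ≈⟨ +-cong (×-homo-+ 1# a c) (-‿cong (×-homo-+ 1# b d)) ⟩
      (a · 1# + c · 1#) - (b · 1# + d · 1#)         ≈⟨ +-congˡ (-‿+-comm _ _) ⟨
      (a · 1# + c · 1#) + (- (b · 1#) - d · 1#)     ≈⟨ interchange _ _ _ _ ⟩
      (a · 1# - b · 1#) + (c · 1# - d · 1#)         ≈⟨ +-cong (difference≈ a b) (difference≈ c d) ⟨
      difference (a , b) + difference (c , d)       ∎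

    *-homo : ∀ x y → difference (RawRing._*_ differences x y) ≈ difference x * difference y
    *-homo (a , b) (c , d) = begin
      difference (reduce (a ℕ.* c ℕ.+ b ℕ.* d , a ℕ.* d ℕ.+ b ℕ.* c))
        ≈⟨ difference-reduce (a ℕ.* c ℕ.+ b ℕ.* d) (a ℕ.* d ℕ.+ b ℕ.* c) ⟩
      (a ℕ.* c ℕ.+ b ℕ.* d) · 1# - (a ℕ.* d ℕ.+ b ℕ.* c) · 1#
        ≈⟨ +-cong (homo a c b d) (-‿cong (homo a d b c)) ⟩
      (A * C + B * D) - (A * D + B * C)
        ≈⟨ +-cong (+-congˡ (-x*-y≈x*y B D)) (-‿+-comm _ _) ⟨
      (A * C + - B * - D) + (- (A * D) - B * C)
        ≈⟨ +-congˡ (+-cong (-‿distribʳ-* A D) (-‿distribˡ-* B C)) ⟩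
      (A * C + - B * - D) + (A * - D + - B * C)
        ≈⟨ solve⁺ 4 (λ x y z w → (x ⊕ y) ⊕ (z ⊕ w) ⊜ (x ⊕ z) ⊕ (w ⊕ y)) refl _ _ _ _ ⟩
      (A * C + A * - D) + (- B * C + - B * - D)
        ≈⟨ +-cong (distribˡ A C (- D)) (distribˡ (- B) C (- D)) ⟨
      A * (C - D) + - B * (C - D)
        ≈⟨ distribʳ (C - D) A (- B) ⟨
      (A - B) * (C - D)
        ≈⟨ *-cong (difference≈ a b) (difference≈ c d) ⟨
      difference (a , b) * difference (c , d) ∎
      where
      A = a · 1#
      B = b · 1#
      C = c · 1#
      D = d · 1#
      homo : ∀ p q r s → (p ℕ.* q ℕ.+ r ℕ.* s) · 1# ≈ (p · 1#) * (q · 1#) + (r · 1#) * (s · 1#)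
      homo p q r s = trans (×-homo-+ 1# (p ℕ.* q) (r ℕ.* s)) (+-cong (×1-homo-* p q) (×1-homo-* r s))

    -‿homo : ∀ x → difference (RawRing.-_ differences x) ≈ - difference x
    -‿homo (a , b) = begin
      difference (b , a)   ≈⟨ difference≈ b a ⟩
      b · 1# - a · 1#      ≈⟨ ⁻¹-anti-homo‿- _ _ ⟨
      - (a · 1# - b · 1#)  ≈⟨ -‿cong (difference≈ a b) ⟨
      - difference (a , b) ∎

    morphism : differences -Raw-AlmostCommutative⟶ fromCommutativeRing R
    morphism = record
      { ⟦_⟧    = difference
      ; +-homo = +-homo
      ; *-homo = *-homo
      ; -‿homo = -‿homo
      ; 0-homo = refl
      ; 1-homo = refl
      }

    difference-≟ : ∀ x y → Maybe (difference x ≈ difference y)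
    difference-≟ (a , b) (c , d) with a ℕ.+ d ℕ.≟ c ℕ.+ b
    ... | no  _  = nothing
    ... | yes eq = just (x∙y⁻¹≈ε⇒x≈y _ _ (begin
      difference (a , b) - difference (c , d) ≈⟨ +-congˡ (-‿homo (c , d)) ⟨
      difference (a , b) + difference (d , c) ≈⟨ +-homo (a , b) (d , c) ⟨
      difference (reduce (a ℕ.+ d , b ℕ.+ c)) ≡⟨ ≡.cong₂ (λ m n → difference (reduce (m , n))) eq (ℕ.+-comm b c) ⟩
      difference (reduce (c ℕ.+ b , c ℕ.+ b)) ≈⟨ difference-reduce (c ℕ.+ b) (c ℕ.+ b) ⟩
      (c ℕ.+ b) · 1# - (c ℕ.+ b) · 1#         ≈⟨ -‿inverseʳ _ ⟩
      0#                                      ∎))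

  open Algebra.Solver.Ring differences (fromCommutativeRing R) morphism difference-≟ public
    using (Polynomial; solve; _:=_; _:+_; _:*_; _:-_; :-_; con)

  #0 #1 : ∀ {n} → Polynomial n
  #0 = con (0 , 0)
  #1 = con (1 , 0)

-- Power series

module PowerSeries {c ℓ} (R : CommutativeRing c ℓ) where

  open CommutativeRing R
  open IntegerCoefficients R
  open import Algebra.Properties.Monoid.Sum +-monoid using (sum⁺-syntax)
  open import Relation.Binary.Reasoning.Setoid setoid

  infixl 7 _⊛_

  -- The Cauchy product, by recursion on the degree: (f₀ + x f′) g = f₀ g + x (f′ g).
  _⊛_ : (ℕ → Carrier) → (ℕ → Carrier) → (ℕ → Carrier)
  (f ⊛ g) zero    = f 0 * g 0
  (f ⊛ g) (suc n) = f 0 * g (suc n) + ((λ i → f (suc i)) ⊛ g) n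

  constant : Carrier → ℕ → Carrier
  constant a zero    = a
  constant a (suc _) = 0#

  -- Links the recursive product to the finite sums that define `_*ˢ_`: the first term of the sum is
  -- the first step of the recursion.
  ⊛-sum : ∀ f g n → ∑[ i ≤ n ] (f (toℕ i) * g (n ∸ toℕ i)) ≈ (f ⊛ g) n
  ⊛-sum f g zero    = +-identityʳ _
  ⊛-sum f g (suc n) = +-congˡ (⊛-sum (λ i → f (suc i)) g n)

  ⊛-cong : ∀ {f f′ g g′} → (∀ n → f n ≈ f′ n) → (∀ n → g n ≈ g′ n) → ∀ n → (f ⊛ g) n ≈ (f′ ⊛ g′) n
  ⊛-cong p q zero    = *-cong (p 0) (q 0)
  ⊛-cong p q (suc n) = +-cong (*-cong (p 0) (q (suc n))) (⊛-cong (λ i → p (suc i)) q n)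

  ⊛-sucʳ : ∀ f g n → (f ⊛ g) (suc n) ≈ (f ⊛ λ i → g (suc i)) n + f (suc n) * g 0
  ⊛-sucʳ f g zero    = refl
  ⊛-sucʳ f g (suc n) = trans (+-congˡ (⊛-sucʳ (λ i → f (suc i)) g n)) (sym (+-assoc _ _ _))

  ⊛-comm : ∀ f g n → (f ⊛ g) n ≈ (g ⊛ f) n
  ⊛-comm f g zero    = *-comm _ _
  ⊛-comm f g (suc n) = begin
    f 0 * g (suc n) + ((λ i → f (suc i)) ⊛ g) n ≈⟨ +-cong (*-comm _ _) (⊛-comm (λ i → f (suc i)) g n) ⟩
    g (suc n) * f 0 + (g ⊛ λ i → f (suc i)) n   ≈⟨ +-comm _ _ ⟩
    (g ⊛ λ i → f (suc i)) n + g (suc n) * f 0   ≈⟨ ⊛-sucʳ g f n ⟨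
    (g ⊛ f) (suc n) ∎

  ⊛-distribʳ : ∀ h f g n → ((λ i → f i + g i) ⊛ h) n ≈ (f ⊛ h) n + (g ⊛ h) n
  ⊛-distribʳ h f g zero    = distribʳ _ _ _
  ⊛-distribʳ h f g (suc n) = trans
    (+-congˡ (⊛-distribʳ h (λ i → f (suc i)) (λ i → g (suc i)) n))
    (solve 5 (λ a b c d e → (a :+ b) :* c :+ (d :+ e) := (a :* c :+ d) :+ (b :* c :+ e)) refl _ _ _ _ _)

  ⊛-scale : ∀ a f g n → ((λ i → a * f i) ⊛ g) n ≈ a * (f ⊛ g) n
  ⊛-scale a f g zero    = *-assoc _ _ _
  ⊛-scale a f g (suc n) = trans
    (+-congˡ (⊛-scale a (λ i → f (suc i)) g n))
    (solve 4 (λ a b c d → (a :* b) :* c :+ a :* d := a :* (b :* c :+ d)) refl _ _ _ _)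

  ⊛-assoc : ∀ f g h n → ((f ⊛ g) ⊛ h) n ≈ (f ⊛ (g ⊛ h)) n
  ⊛-assoc f g h zero    = *-assoc _ _ _
  ⊛-assoc f g h (suc n) = begin
    (f 0 * g 0) * h (suc n) + ((λ i → f 0 * g (suc i) + (f₊ ⊛ g) i) ⊛ h) n
      ≈⟨ +-congˡ (⊛-distribʳ h _ _ n) ⟩
    (f 0 * g 0) * h (suc n) + (((λ i → f 0 * g (suc i)) ⊛ h) n + ((f₊ ⊛ g) ⊛ h) n)
      ≈⟨ +-congˡ (+-cong (⊛-scale (f 0) _ h n) (⊛-assoc f₊ g h n)) ⟩
    (f 0 * g 0) * h (suc n) + (f 0 * ((λ i → g (suc i)) ⊛ h) n + (f₊ ⊛ (g ⊛ h)) n)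
      ≈⟨ solve 5 (λ a b c d e → (a :* b) :* c :+ (a :* d :+ e) := a :* (b :* c :+ d) :+ e) refl _ _ _ _ _ ⟩
    f 0 * (g 0 * h (suc n) + ((λ i → g (suc i)) ⊛ h) n) + (f₊ ⊛ (g ⊛ h)) n ∎
    where
    f₊ : ℕ → Carrier
    f₊ i = f (suc i)

  ⊛-zeroˡ : ∀ g n → ((λ _ → 0#) ⊛ g) n ≈ 0#
  ⊛-zeroˡ g zero    = zeroˡ _
  ⊛-zeroˡ g (suc n) = trans (+-cong (zeroˡ _) (⊛-zeroˡ g n)) (+-identityˡ 0#)

  constant-⊛ : ∀ a f n → (constant a ⊛ f) n ≈ a * f n
  constant-⊛ a f zero    = refl
  constant-⊛ a f (suc n) = trans (+-congˡ (⊛-zeroˡ f n)) (+-identityʳ _)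

  -- With y as the variable: a y-free series acts as a scalar on the coefficients of the powers of
  -- y. `Δ-*` rests on this.
  ⊛-constantˡ : ∀ f g → (∀ n → f (suc n) ≈ 0#) → ∀ n → (f ⊛ g) n ≈ f 0 * g n
  ⊛-constantˡ f g f₊≈0 n = trans (⊛-cong {g = g} f≈ (λ _ → refl) n) (constant-⊛ (f 0) g n)
    where
    f≈ : ∀ i → f i ≈ constant (f 0) i
    f≈ zero    = refl
    f≈ (suc i) = f₊≈0 i

  ⊛-identityˡ : ∀ f n → (constant 1# ⊛ f) n ≈ f n
  ⊛-identityˡ f n = trans (constant-⊛ 1# f n) (*-identityˡ _)

  commutativeRing : CommutativeRing c ℓ
  commutativeRing = record
    { Carrier = ℕ → Carrier
    ; _≈_     = λ f g → ∀ n → f n ≈ g n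
    ; _+_     = λ f g n → f n + g n
    ; _*_     = _⊛_
    ; -_      = λ f n → - f n
    ; 0#      = λ _ → 0#
    ; 1#      = constant 1#
    ; isCommutativeRing = record
      { isRing = record
        { +-isAbelianGroup = record
          { isGroup = record
            { isMonoid = record
              { isSemigroup = record
                { isMagma = record
                  { isEquivalence = record
                    { refl  = λ _ → refl
                    ; sym   = λ p n → sym (p n)
                    ; trans = λ p q n → trans (p n) (q n)
                    }
                  ; ∙-cong = λ p q n → +-cong (p n) (q n)
                  }
                ; assoc = λ f g h n → +-assoc _ _ _
                }
              ; identity = (λ f n → +-identityˡ _) , (λ f n → +-identityʳ _)
              }
            ; inverse = (λ f n → -‿inverseˡ _) , (λ f n → -‿inverseʳ _)
            ; ⁻¹-cong = λ p n → -‿cong (p n)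
            }
          ; comm = λ f g n → +-comm _ _
          }
        ; *-cong = ⊛-cong
        ; *-assoc = ⊛-assoc
        ; *-identity = ⊛-identityˡ , (λ f n → trans (⊛-comm f _ n) (⊛-identityˡ f n))
        ; distrib = (λ h f g n → trans (⊛-comm h _ n) (trans (⊛-distribʳ h f g n) (+-cong (⊛-comm f h n) (⊛-comm g h n))))
                  , ⊛-distribʳ
        }
      ; *-comm = ⊛-comm
      }
    }

  shift : (ℕ → Carrier) → ℕ → Carrier
  shift f zero    = 0#
  shift f (suc n) = f n

  variable-⊛ : ∀ f n → (shift (constant 1#) ⊛ f) n ≈ shift f n
  variable-⊛ f zero    = zeroˡ _
  variable-⊛ f (suc n) = trans (+-cong (zeroˡ _) (⊛-identityˡ f n)) (+-identityˡ _)

-- The kernel equation, as identities in an arbitrary commutative ring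

module KernelMethod {c ℓ} (R : CommutativeRing c ℓ) where

  open CommutativeRing R
  open IntegerCoefficients R
  open import Relation.Binary.Reasoning.Setoid setoid

  -- g, s, s′, s″ stand for G, ΔG, Δ²G, Δ³G and g₀, g₁ for their y-free parts.
  module _ (x y z : Carrier) where

    a : Carrier
    a = 1# - x - z

    inverse : ∀ g₀ → g₀ ≈ 1# + x * g₀ + z * g₀ → a * g₀ ≈ 1#
    inverse g₀ p = begin
      a * g₀
        ≈⟨ solve 3 (λ x z g → (#1 :- x :- z) :* g := g :- (#1 :+ x :* g :+ z :* g) :+ #1) refl x z g₀ ⟩
      g₀ - (1# + x * g₀ + z * g₀) + 1#
        ≈⟨ +-congʳ (+-congˡ (-‿cong p)) ⟨
      g₀ - g₀ + 1#
        ≈⟨ trans (+-congʳ (-‿inverseʳ g₀)) (+-identityˡ 1#) ⟩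
      1# ∎

    -- The recurrence is linear, so `t * g - s` inherits it from `g` and `s`. The members `d`, `d′`,
    -- `d″` enter only up to `≈` because lowering the power of y in a product `t * g` gives `t * s`
    -- only propositionally.
    defect-recurrence : ∀ t g s s′ s″ {d d′ d″} →
      d ≈ t * g - s → d′ ≈ t * s - s′ → d″ ≈ t * s′ - s″ →
      s ≈ g + x * s + z * s + x * (z * s′) →
      s′ ≈ s + x * s′ + z * s′ + x * (z * s″) →
      d′ ≈ d + x * d′ + z * d′ + x * (z * d″)
    defect-recurrence t g s s′ s″ {d} {d′} {d″} e e′ e″ p q = begin
      d′
        ≈⟨ e′ ⟩
      t * s - s′
        ≈⟨ +-cong (*-congˡ p) (-‿cong q) ⟩
      t * (g + x * s + z * s + x * (z * s′)) - (s + x * s′ + z * s′ + x * (z * s″))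
        ≈⟨ solve 7 (λ x z t g s s′ s″ →
             t :* (g :+ x :* s :+ z :* s :+ x :* (z :* s′)) :- (s :+ x :* s′ :+ z :* s′ :+ x :* (z :* s″))
             := (t :* g :- s) :+ x :* (t :* s :- s′) :+ z :* (t :* s :- s′) :+ x :* (z :* (t :* s′ :- s″)))
             refl x z t g s s′ s″ ⟩
      (t * g - s) + x * (t * s - s′) + z * (t * s - s′) + x * (z * (t * s′ - s″))
        ≈⟨ +-cong (+-cong (+-cong e (*-congˡ e′)) (*-congˡ e′)) (*-congˡ (*-congˡ e″)) ⟨
      d + x * d′ + z * d′ + x * (z * d″) ∎

    -- For `t = a * g₁` the y-free part of `t * g - s` is `g₁ * (a * g₀) - g₁`, which cancels since
    -- `a` inverts `g₀`. It is the initial condition for the uniqueness argument.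
    defect-multiple : ∀ g g₀ g₁ s s′ → g ≈ g₀ + y * s → s ≈ g₁ + y * s′ → a * g₀ ≈ 1# →
      a * g₁ * g - s ≈ y * (a * g₁ * s - s′)
    defect-multiple g g₀ g₁ s s′ p q r = begin
      a * g₁ * g - s
        ≈⟨ +-cong (*-congˡ p) (-‿cong q) ⟩
      a * g₁ * (g₀ + y * s) - (g₁ + y * s′)
        ≈⟨ solve 6 (λ a g₀ g₁ s s′ y → a :* g₁ :* (g₀ :+ y :* s) :- (g₁ :+ y :* s′)
             := g₁ :* (a :* g₀) :- g₁ :+ y :* (a :* g₁ :* s :- s′)) refl a g₀ g₁ s s′ y ⟩
      g₁ * (a * g₀) - g₁ + y * (a * g₁ * s - s′)
        ≈⟨ +-congʳ (+-congʳ (trans (*-congˡ r) (*-identityʳ g₁))) ⟩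
      g₁ - g₁ + y * (a * g₁ * s - s′)
        ≈⟨ trans (+-congʳ (-‿inverseʳ g₁)) (+-identityˡ _) ⟩
      y * (a * g₁ * s - s′) ∎

    quadratic : Carrier → Carrier
    quadratic t = a * t - 1# - x * z * (t * t)

    -- Putting `t * g` for `s` and `t * (t * g)` for `s′` in the recurrence gives
    -- `quadratic t * g ≈ 0#`. Splitting `g` then exhibits `quadratic t * g₀` as a multiple of y;
    -- for y-free `t` and `g₀` it has to vanish.
    quadratic-multiple : ∀ t g g₀ s s′ → g ≈ g₀ + y * s → s ≈ g + x * s + z * s + x * (z * s′) →
      t * g ≈ s → t * s ≈ s′ → quadratic t * g₀ ≈ y * (- (quadratic t * s))
    quadratic-multiple t g g₀ s s′ p q tg ts = begin
      quadratic t * g₀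
        ≈⟨ solve 4 (λ f g₀ y s → f :* g₀ := f :* (g₀ :+ y :* s) :+ y :* (:- (f :* s))) refl (quadratic t) g₀ y s ⟩
      quadratic t * (g₀ + y * s) + y * (- (quadratic t * s))
        ≈⟨ +-congʳ (trans (*-congˡ (sym p)) vanish) ⟩
      0# + y * (- (quadratic t * s))
        ≈⟨ +-identityˡ _ ⟩
      y * (- (quadratic t * s)) ∎
      where
      vanish : quadratic t * g ≈ 0#
      vanish = begin
        quadratic t * g
          ≈⟨ solve 4 (λ x z t g → ((#1 :- x :- z) :* t :- #1 :- x :* z :* (t :* t)) :* g
               := t :* g :- x :* (t :* g) :- z :* (t :* g) :- g :- x :* (z :* (t :* (t :* g)))) refl x z t g ⟩
        t * g - x * (t * g) - z * (t * g) - g - x * (z * (t * (t * g)))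
          ≈⟨ +-cong (+-congʳ (+-cong (+-cong tg (-‿cong (*-congˡ tg))) (-‿cong (*-congˡ tg))))
               (-‿cong (*-congˡ (*-congˡ (trans (*-congˡ tg) ts)))) ⟩
        s - x * s - z * s - g - x * (z * s′)
          ≈⟨ +-congʳ (+-congʳ (+-congʳ (+-congʳ q))) ⟩
        g + x * s + z * s + x * (z * s′) - x * s - z * s - g - x * (z * s′)
          ≈⟨ solve 4 (λ g xs zs w → g :+ xs :+ zs :+ w :- xs :- zs :- g :- w := #0) refl _ _ _ _ ⟩
        0# ∎

    quadratic-root : ∀ t g₀ → a * g₀ ≈ 1# → quadratic t * g₀ ≈ 0# → quadratic t ≈ 0#
    quadratic-root t g₀ r p = begin
      quadratic t            ≈⟨ *-identityʳ _ ⟨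
      quadratic t * 1#       ≈⟨ *-congˡ r ⟨
      quadratic t * (a * g₀) ≈⟨ solve 3 (λ f a g₀ → f :* (a :* g₀) := a :* (f :* g₀)) refl (quadratic t) a g₀ ⟩
      a * (quadratic t * g₀) ≈⟨ *-congˡ p ⟩
      a * 0#                 ≈⟨ zeroʳ a ⟩
      0#                     ∎

    -- Expanded: xz - y(1-x-z) + y², the coefficient of `g` after `s = (g - g₀)/y` and
    -- `s′ = (g - g₀ - y g₁)/y²` are put into the recurrence and denominators are cleared. At y =
    -- xzt it equals -xz times `quadratic t`.
    kernel : Carrier
    kernel = (x + y) * (y + z) - y

    kernel-g : ∀ g g₀ g₁ s s′ → g ≈ g₀ + y * s → s ≈ g₁ + y * s′ →
      s ≈ g + x * s + z * s + x * (z * s′) →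
      kernel * g ≈ (kernel - y * y) * g₀ + y * (x * z * g₁)
    kernel-g g g₀ g₁ s s′ p q r = begin
      kernel * g
        ≈⟨ *-congˡ p ⟩
      kernel * (g₀ + y * s)
        ≈⟨ solve 5 (λ x y z g₀ s → ((x :+ y) :* (y :+ z) :- y) :* (g₀ :+ y :* s)
             := ((x :+ y) :* (y :+ z) :- y) :* g₀ :+ y :* (x :* z :* s :+ y :* y :* s :- y :* (s :- x :* s :- z :* s)))
             refl x y z g₀ s ⟩
      kernel * g₀ + y * (x * z * s + y * y * s - y * (s - x * s - z * s))
        -- Expanding both `s` and `g` once more makes `x * z * s′` and `y * y * s` occur with both
        -- signs, so that only `g₀` and `g₁` survive.
        ≈⟨ +-congˡ (*-congˡ (+-cong (+-congʳ (*-congˡ q)) (-‿cong (*-congˡ (begin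
           s - x * s - z * s
             ≈⟨ +-congʳ (+-congʳ r) ⟩
           g + x * s + z * s + x * (z * s′) - x * s - z * s
             ≈⟨ solve 4 (λ g u v w → g :+ u :+ v :+ w :- u :- v := g :+ w) refl _ _ _ _ ⟩
           g + x * (z * s′)
             ≈⟨ +-congʳ p ⟩
           g₀ + y * s + x * (z * s′) ∎))))) ⟩
      kernel * g₀ + y * (x * z * (g₁ + y * s′) + y * y * s - y * (g₀ + y * s + x * (z * s′)))
        ≈⟨ solve 8 (λ k x y z g₀ g₁ s s′ →
             k :* g₀ :+ y :* (x :* z :* (g₁ :+ y :* s′) :+ y :* y :* s :- y :* (g₀ :+ y :* s :+ x :* (z :* s′)))
             := (k :- y :* y) :* g₀ :+ y :* (x :* z :* g₁)) refl kernel x y z g₀ g₁ s s′ ⟩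
      (kernel - y * y) * g₀ + y * (x * z * g₁) ∎

    -- The 2 of the closed form is a constant series, equal to `1# + 1#` only up to `≈`, hence a
    -- parameter.
    module _ (two : Carrier) (two≈1+1 : two ≈ 1# + 1#) where

      root : Carrier → Carrier
      root t = a - two * x * z * t

      -- The square is a² - 4xz - 4xz `quadratic t`, and a² - 4xz = 1 - 2(x+z) + (x-z)² is the
      -- discriminant of the quadratic.
      root² : ∀ t → quadratic t ≈ 0# →
        root t * root t ≈ 1# - two * (x + z) + (x - z) * (x - z)
      root² t p = begin
        root t * root t
          ≈⟨ *-cong root≈ root≈ ⟩
        (a - (1# + 1#) * x * z * t) * (a - (1# + 1#) * x * z * t)
          ≈⟨ solve 3 (λ x z t →
               (#1 :- x :- z :- (#1 :+ #1) :* x :* z :* t) :* (#1 :- x :- z :- (#1 :+ #1) :* x :* z :* t)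
               := #1 :- (#1 :+ #1) :* (x :+ z) :+ (x :- z) :* (x :- z)
                 :- con (4 , 0) :* x :* z :* ((#1 :- x :- z) :* t :- #1 :- x :* z :* (t :* t))) refl x z t ⟩
        1# - (1# + 1#) * (x + z) + (x - z) * (x - z) - difference (4 , 0) * x * z * quadratic t
          ≈⟨ +-cong (+-congʳ (+-congˡ (-‿cong (*-congʳ (sym two≈1+1))))) (-‿cong (*-congˡ p)) ⟩
        1# - two * (x + z) + (x - z) * (x - z) - difference (4 , 0) * x * z * 0#
          ≈⟨ solve 2 (λ u v → u :- v :* #0 := u) refl _ _ ⟩
        1# - two * (x + z) + (x - z) * (x - z) ∎
        where
        root≈ : root t ≈ a - (1# + 1#) * x * z * t
        root≈ = +-congˡ (-‿cong (*-congʳ (*-congʳ (*-congʳ two≈1+1))))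

      -- Multiplying `kernel-g` by 2a turns `a * g₀` into 1 and leaves `g₁` only in t = `a * g₁`;
      -- then 2xzt is `a - root t`.
      functional-equation : ∀ g g₀ g₁ s s′ → g ≈ g₀ + y * s → s ≈ g₁ + y * s′ →
        s ≈ g + x * s + z * s + x * (z * s′) → a * g₀ ≈ 1# →
        g * (two * a * kernel) ≈ two * x * z - y * a - y * root (a * g₁)
      functional-equation g g₀ g₁ s s′ p q r e = begin
        g * (two * a * kernel)
          ≈⟨ solve 4 (λ g w a k → g :* (w :* a :* k) := w :* a :* (k :* g)) refl g two a kernel ⟩
        two * a * (kernel * g)
          ≈⟨ *-congˡ (kernel-g g g₀ g₁ s s′ p q r) ⟩
        two * a * ((kernel - y * y) * g₀ + y * (x * z * g₁))
          ≈⟨ solve 6 (λ w x y z g₀ g₁ → w :* (#1 :- x :- z) :*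
                 (((x :+ y) :* (y :+ z) :- y :- y :* y) :* g₀ :+ y :* (x :* z :* g₁))
               := w :* (x :* z :- y :* (#1 :- x :- z)) :* ((#1 :- x :- z) :* g₀)
                 :+ y :* (w :* x :* z :* ((#1 :- x :- z) :* g₁))) refl two x y z g₀ g₁ ⟩
        two * (x * z - y * a) * (a * g₀) + y * (two * x * z * (a * g₁))
          ≈⟨ +-congʳ (trans (*-congˡ e) (*-identityʳ _)) ⟩
        two * (x * z - y * a) + y * (two * x * z * (a * g₁))
          ≈⟨ +-congʳ (solve 4 (λ w x z v → w :* (x :* z :- v) := w :* x :* z :- w :* v) refl two x z (y * a)) ⟩
        two * x * z - two * (y * a) + y * (two * x * z * (a * g₁))
          ≈⟨ +-congʳ (+-congˡ (-‿cong (*-congʳ two≈1+1))) ⟩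
        two * x * z - (1# + 1#) * (y * a) + y * (two * x * z * (a * g₁))
          ≈⟨ solve 4 (λ u y a v → u :- (#1 :+ #1) :* (y :* a) :+ y :* v := u :- y :* a :- y :* (a :- v)) refl _ _ _ _ ⟩
        two * x * z - y * a - y * root (a * g₁) ∎

-- Ordered fields

module OrderedFieldProperties {c ℓ₁ ℓ₂ ℓ₃} (K : OrderedField c ℓ₁ ℓ₂ ℓ₃) where

  open OrderedField K
  private
    commutativeRing : CommutativeRing c ℓ₁
    commutativeRing = HeytingCommutativeRing.commutativeRing heytingCommutativeRing

  open CommutativeRing commutativeRing public
    using (ring) renaming (sym to ≈-sym; trans to ≈-trans; refl to ≈-refl; setoid to ≈-setoid)
  open IntegerCoefficients commutativeRing public
  open Algebra.Apartness.Properties.HeytingCommutativeRing heytingCommutativeRing using (1#0; x-0≈x)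
  module < = IsStrictPartialOrder isStrictPartialOrder
  open import Relation.Binary.Reasoning.Setoid ≈-setoid

  <-resp-≈ : ∀ {x x′ y y′} → x ≈ x′ → y ≈ y′ → x < y → x′ < y′
  <-resp-≈ p q x<y = <.<-respˡ-≈ p (<.<-respʳ-≈ q x<y)

  ≤-resp-≈ : ∀ {x x′ y y′} → x ≈ x′ → y ≈ y′ → x ≤ y → x′ ≤ y′
  ≤-resp-≈ p q x≤y y′<x′ = x≤y (<-resp-≈ (≈-sym q) (≈-sym p) y′<x′)

  ≤-reflexive : ∀ {x y} → x ≈ y → x ≤ y
  ≤-reflexive x≈y = <.irrefl (≈-sym x≈y)

  ≤-refl : ∀ {x} → x ≤ x
  ≤-refl = ≤-reflexive ≈-refl

  <⇒≤ : ∀ {x y} → x < y → x ≤ y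
  <⇒≤ x<y = <.asym x<y

  -- Since `≤` is a mere negation, the strict inequality has to be produced by cotransitivity: one
  -- of `x`, `y` is apart from `z`, and the wrong orders are refuted.
  <-≤-trans : ∀ {x y z} → x < y → y ≤ z → x < z
  <-≤-trans {x} {y} {z} x<y y≤z with #-cotrans (<⇒# x<y) z
  ... | inj₂ z#y with #⇒<⊎> z#y
  ...   | inj₁ z<y = contradiction z<y y≤z
  ...   | inj₂ y<z = <.trans x<y y<z
  <-≤-trans {x} {y} {z} x<y y≤z | inj₁ x#z with #⇒<⊎> x#z
  ...   | inj₁ x<z = x<z
  ...   | inj₂ z<x = contradiction (<.trans z<x x<y) y≤z

  ≤-<-trans : ∀ {x y z} → x ≤ y → y < z → x < z
  ≤-<-trans {x} {y} {z} x≤y y<z with #-cotrans (<⇒# y<z) x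
  ... | inj₁ y#x with #⇒<⊎> y#x
  ...   | inj₁ y<x = contradiction y<x x≤y
  ...   | inj₂ x<y = <.trans x<y y<z
  ≤-<-trans {x} {y} {z} x≤y y<z | inj₂ x#z with #⇒<⊎> x#z
  ...   | inj₁ x<z = x<z
  ...   | inj₂ z<x = contradiction (<.trans y<z z<x) x≤y

  ≤-trans : ∀ {x y z} → x ≤ y → y ≤ z → x ≤ z
  ≤-trans x≤y y≤z z<x = x≤y (≤-<-trans y≤z z<x)

  ≤-antisym : ∀ {x y} → x ≤ y → y ≤ x → x ≈ y
  ≤-antisym {x} {y} x≤y y≤x = proj₁ (tight x y) λ x#y → case (#⇒<⊎> x#y)
    where
    case : ¬ (x < y ⊎ y < x)
    case (inj₁ x<y) = y≤x x<y
    case (inj₂ y<x) = x≤y y<x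

  -- Trichotomy is available under double negation only. That suffices for goals such as `≤`, which
  -- are negations themselves.
  ¬¬-trichotomy : ∀ x y → ¬ x < y → ¬ x ≈ y → ¬ y < x → ⊥
  ¬¬-trichotomy x y ¬< ¬≈ ¬> = ¬≈ (≤-antisym ¬> ¬<)

  x<y⇒0<y-x : ∀ {x y} → x < y → 0# < y - x
  x<y⇒0<y-x {x} x<y = <-resp-≈ (-‿inverseʳ x) ≈-refl (+-monoˡ-< (- x) x<y)

  0<y-x⇒x<y : ∀ {x y} → 0# < y - x → x < y
  0<y-x⇒x<y {x} {y} p = <-resp-≈ (+-identityˡ x)
    (solve 2 (λ x y → y :- x :+ x := y) ≈-refl x y) (+-monoˡ-< x p)

  x≤y⇒0≤y-x : ∀ {x y} → x ≤ y → 0# ≤ y - x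
  x≤y⇒0≤y-x {x} {y} x≤y y-x<0 = x≤y (<-resp-≈
    (solve 2 (λ x y → y :- x :+ x := y) ≈-refl x y) (+-identityˡ x) (+-monoˡ-< x y-x<0))

  0≤y-x⇒x≤y : ∀ {x y} → 0# ≤ y - x → x ≤ y
  0≤y-x⇒x≤y {x} {y} p y<x = p (<-resp-≈ ≈-refl (-‿inverseʳ x) (+-monoˡ-< (- x) y<x))

  +-pos : ∀ {x y} → 0# < x → 0# < y → 0# < x + y
  +-pos {x} {y} 0<x 0<y = <.trans 0<y (<-resp-≈ (+-identityˡ y) ≈-refl (+-monoˡ-< y 0<x))

  +-pos-nonneg : ∀ {x y} → 0# < x → 0# ≤ y → 0# < x + y
  +-pos-nonneg {x} {y} 0<x 0≤y = ≤-<-trans 0≤y (<-resp-≈ (+-identityˡ y) ≈-refl (+-monoˡ-< y 0<x))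

  +-nonneg : ∀ {x y} → 0# ≤ x → 0# ≤ y → 0# ≤ x + y
  +-nonneg {x} {y} 0≤x 0≤y x+y<0 = 0≤x (<-resp-≈ (solve 2 (λ x y → x :+ y :- y := x) ≈-refl x y) ≈-refl
    (<-≤-trans (+-monoˡ-< (- y) x+y<0)
      (0≤y-x⇒x≤y (≤-resp-≈ ≈-refl (solve 1 (λ y → y := #0 :- (#0 :- y)) ≈-refl y) 0≤y))))

  *-nonneg : ∀ {x y} → 0# ≤ x → 0# ≤ y → 0# ≤ x * y
  *-nonneg {x} {y} 0≤x 0≤y xy<0 = ¬¬-trichotomy 0# x
    (λ 0<x → ¬¬-trichotomy 0# y (λ 0<y → <.asym (*-pos 0<x 0<y) xy<0)
      (λ 0≈y → <.irrefl (≈-trans (*-congˡ (≈-sym 0≈y)) (zeroʳ x)) xy<0) 0≤y)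
    (λ 0≈x → <.irrefl (≈-trans (*-congʳ (≈-sym 0≈x)) (zeroˡ y)) xy<0) 0≤x

  square-nonneg : ∀ x → 0# ≤ x * x
  square-nonneg x xx<0 = ¬¬-trichotomy 0# x
    (λ 0<x → <.asym (*-pos 0<x 0<x) xx<0)
    (λ 0≈x → <.irrefl (≈-trans (*-congʳ (≈-sym 0≈x)) (zeroˡ x)) xx<0)
    (λ x<0 → <.asym (<-resp-≈ ≈-refl (solve 1 (λ x → (#0 :- x) :* (#0 :- x) := x :* x) ≈-refl x)
      (*-pos (x<y⇒0<y-x x<0) (x<y⇒0<y-x x<0))) xx<0)

  0<1 : 0# < 1#
  0<1 with #⇒<⊎> 1#0
  ... | inj₁ 1<0 = contradiction (<-resp-≈ (≈-sym (*-identityˡ 1#)) ≈-refl 1<0) (square-nonneg 1#)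
  ... | inj₂ 0<1 = 0<1

  0≤1 : 0# ≤ 1#
  0≤1 = <⇒≤ 0<1

  x<x+1 : ∀ x → x < 1# + x
  x<x+1 x = <-resp-≈ (+-identityˡ x) ≈-refl (+-monoˡ-< x 0<1)

  #⇒inverse : ∀ {x y} → x # y → Σ Carrier λ z → z * (x - y) ≈ 1#
  #⇒inverse x#y = proj₁ (#⇒invertible x#y) , proj₁ (proj₂ (#⇒invertible x#y))

  *-cancel-# : ∀ {x y z} → x # y → (x - y) * z ≈ 0# → z ≈ 0#
  *-cancel-# {x} {y} {z} x#y p with #⇒inverse x#y
  ... | i , i[x-y]≈1 = begin
    z                   ≈⟨ *-identityˡ z ⟨
    1# * z              ≈⟨ *-congʳ i[x-y]≈1 ⟨
    i * (x - y) * z     ≈⟨ *-assoc i _ z ⟩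
    i * ((x - y) * z)   ≈⟨ *-congˡ p ⟩
    i * 0#              ≈⟨ zeroʳ i ⟩
    0#                  ∎

  x-y≈0⇒x≈y : ∀ {x y} → x - y ≈ 0# → x ≈ y
  x-y≈0⇒x≈y {x} {y} p = begin
    x           ≈⟨ solve 2 (λ x y → x := (x :- y) :+ y) ≈-refl x y ⟩
    (x - y) + y ≈⟨ +-congʳ p ⟩
    0# + y      ≈⟨ +-identityˡ y ⟩
    y           ∎

  positive-inverse : ∀ {x} → 0# < x → Σ Carrier λ y → 0# < y × x * y ≈ 1#
  positive-inverse {x} 0<x with #⇒inverse (#-sym (<⇒# 0<x))
  ... | y , y[x-0]≈1 = y , 0<y , xy≈1
    where
    xy≈1 : x * y ≈ 1#
    xy≈1 = ≈-trans (solve 2 (λ x y → x :* y := y :* (x :- #0)) ≈-refl x y) y[x-0]≈1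
    0<y : 0# < y
    0<y with #⇒<⊎> (invertible⇒# {y} {0#} (x , ≈-trans (*-congˡ (x-0≈x y)) xy≈1 , ≈-trans (*-comm _ _) (≈-trans (*-congˡ (x-0≈x y)) xy≈1)))
    ... | inj₂ 0<y = 0<y
    ... | inj₁ y<0 = contradiction
      (<-resp-≈ (+-identityˡ 1#) (begin
        x * (0# - y) + 1#     ≈⟨ solve 2 (λ x y → x :* (#0 :- y) :+ #1 := #1 :- x :* y) ≈-refl x y ⟩
        1# - x * y            ≈⟨ +-congˡ (-‿cong xy≈1) ⟩
        1# - 1#               ≈⟨ -‿inverseʳ 1# ⟩
        0#                    ∎) (+-monoˡ-< 1# (*-pos 0<x (x<y⇒0<y-x y<0))))
      0≤1

  ½∃ : Σ Carrier λ h → 0# < h × (1# + 1#) * h ≈ 1#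
  ½∃ = positive-inverse (+-pos 0<1 0<1)

  ½ : Carrier
  ½ = proj₁ ½∃

  0<½ : 0# < ½
  0<½ = proj₁ (proj₂ ½∃)

  2*½≈1 : (1# + 1#) * ½ ≈ 1#
  2*½≈1 = proj₂ (proj₂ ½∃)

  1-½≈½ : 1# - ½ ≈ ½
  1-½≈½ = begin
    1# - ½                 ≈⟨ +-congʳ 2*½≈1 ⟨
    (1# + 1#) * ½ - ½      ≈⟨ solve 1 (λ h → (#1 :+ #1) :* h :- h := h) ≈-refl ½ ⟩
    ½                      ∎

  ½<1 : ½ < 1#
  ½<1 = 0<y-x⇒x<y (<-resp-≈ ≈-refl (≈-sym 1-½≈½) 0<½)

  nonneg-combination-zero : ∀ {s t x y} → 0# < s → 0# < t → 0# ≤ x → 0# ≤ y →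
    s * x + t * y ≈ 0# → x ≈ 0# × y ≈ 0#
  nonneg-combination-zero {s} {t} {x} {y} 0<s 0<t 0≤x 0≤y p =
      ≤-antisym (λ 0<x → <.irrefl (≈-sym p) (+-pos-nonneg (*-pos 0<s 0<x) (*-nonneg (<⇒≤ 0<t) 0≤y))) 0≤x
    , ≤-antisym (λ 0<y → <.irrefl (≈-sym (≈-trans (+-comm _ _) p))
        (+-pos-nonneg (*-pos 0<t 0<y) (*-nonneg (<⇒≤ 0<s) 0≤x))) 0≤y

  minimum-extreme : ∀ {a t x y} → 0# < t → t < 1# → a ≤ x → a ≤ y →
    a ≈ t * x + (1# - t) * y → x ≈ a × y ≈ a
  minimum-extreme {a} {t} {x} {y} 0<t t<1 a≤x a≤y p = map x-y≈0⇒x≈y x-y≈0⇒x≈y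
    (nonneg-combination-zero 0<t (x<y⇒0<y-x t<1) (x≤y⇒0≤y-x a≤x) (x≤y⇒0≤y-x a≤y) (begin
      t * (x - a) + (1# - t) * (y - a)
        ≈⟨ solve 4 (λ a t x y → t :* (x :- a) :+ (#1 :- t) :* (y :- a) := t :* x :+ (#1 :- t) :* y :- a) ≈-refl a t x y ⟩
      t * x + (1# - t) * y - a
        ≈⟨ +-congʳ p ⟨
      a - a
        ≈⟨ -‿inverseʳ a ⟩
      0# ∎))

  maximum-extreme : ∀ {b t x y} → 0# < t → t < 1# → x ≤ b → y ≤ b →
    b ≈ t * x + (1# - t) * y → x ≈ b × y ≈ b
  maximum-extreme {b} {t} {x} {y} 0<t t<1 x≤b y≤b p = map (λ q → ≈-sym (x-y≈0⇒x≈y q)) (λ q → ≈-sym (x-y≈0⇒x≈y q))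
    (nonneg-combination-zero 0<t (x<y⇒0<y-x t<1) (x≤y⇒0≤y-x x≤b) (x≤y⇒0≤y-x y≤b) (begin
      t * (b - x) + (1# - t) * (b - y)
        ≈⟨ solve 4 (λ b t x y → t :* (b :- x) :+ (#1 :- t) :* (b :- y) := b :- (t :* x :+ (#1 :- t) :* y)) ≈-refl b t x y ⟩
      b - (t * x + (1# - t) * y)
        ≈⟨ +-congˡ (-‿cong p) ⟨
      b - b
        ≈⟨ -‿inverseʳ b ⟩
      0# ∎))

-- Polynomials that move the entries of a pattern

module Perturbations {c ℓ₁ ℓ₂ ℓ₃} (K : OrderedField c ℓ₁ ℓ₂ ℓ₃) where

  open OrderedField K
  open OrderedFieldProperties K
  open import Relation.Binary.Reasoning.Setoid ≈-setoid

  α β γ : Carrier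
  α = fromℤ (+ 1)
  β = fromℤ (+ 2)
  γ = fromℤ (+ 3)

  α<β : α < β
  α<β = x<x+1 α

  β<γ : β < γ
  β<γ = x<x+1 β

  α<γ : α < γ
  α<γ = <.trans α<β β<γ

  -- Both signs are demanded because an extreme point is to become the midpoint of two points of the
  -- polytope. The two conditions hold when the difference quotients of `q` on [1,3] stay within
  -- [-2,2].
  record Perturbation (q : Carrier → Carrier) : Set (c ⊔ ℓ₁ ⊔ ℓ₃) where
    field
      q-cong : ∀ {x y} → x ≈ y → q x ≈ q y
      mono⁺  : ∀ {x y} → α ≤ x → x ≤ y → y ≤ γ → x + ½ * q x ≤ y + ½ * q y
      mono⁻  : ∀ {x y} → α ≤ x → x ≤ y → y ≤ γ → x - ½ * q x ≤ y - ½ * q y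

  private
    -- With `s` the difference quotient, the increment is (y - x)(1 + s/2) = (y - x) d / 4. Doubling
    -- 2 + s to `d` allows nonnegativity certificates with integer coefficients.
    perturbed-mono : ∀ {x y} u v s {d} → x ≤ y → v - u ≈ (y - x) * s → (1# + 1#) * ((1# + 1#) + s) ≈ d → 0# ≤ d →
      x + ½ * u ≤ y + ½ * v
    perturbed-mono {x} {y} u v s {d} x≤y p q 0≤d = 0≤y-x⇒x≤y (≤-resp-≈ ≈-refl (≈-sym (begin
      (y + ½ * v) - (x + ½ * u)
        ≈⟨ solve 5 (λ x y u v h → (y :+ h :* v) :- (x :+ h :* u) := (y :- x) :* #1 :+ h :* (v :- u)) ≈-refl x y u v ½ ⟩
      (y - x) * 1# + ½ * (v - u)
        ≈⟨ +-cong (*-congˡ (≈-sym 2*½≈1)) (*-congˡ p) ⟩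
      (y - x) * ((1# + 1#) * ½) + ½ * ((y - x) * s)
        ≈⟨ solve 3 (λ w h s → w :* ((#1 :+ #1) :* h) :+ h :* (w :* s) := w :* (h :* (#1 :* (#1 :+ #1 :+ s)))) ≈-refl (y - x) ½ s ⟩
      (y - x) * (½ * (1# * (1# + 1# + s)))
        ≈⟨ *-congˡ (*-congˡ (*-congʳ (≈-sym 2*½≈1))) ⟩
      (y - x) * (½ * ((1# + 1#) * ½ * (1# + 1# + s)))
        ≈⟨ solve 3 (λ w h s → w :* (h :* ((#1 :+ #1) :* h :* (#1 :+ #1 :+ s))) := w :* (h :* (h :* ((#1 :+ #1) :* (#1 :+ #1 :+ s))))) ≈-refl (y - x) ½ s ⟩
      (y - x) * (½ * (½ * ((1# + 1#) * (1# + 1# + s))))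
        ≈⟨ *-congˡ (*-congˡ (*-congˡ q)) ⟩
      (y - x) * (½ * (½ * d)) ∎))
      (*-nonneg (x≤y⇒0≤y-x x≤y) (*-nonneg (<⇒≤ 0<½) (*-nonneg (<⇒≤ 0<½) 0≤d))))

    perturbed-mono⁻ : ∀ {x y} u v s {d} → x ≤ y → v - u ≈ (y - x) * s → (1# + 1#) * ((1# + 1#) - s) ≈ d → 0# ≤ d →
      x - ½ * u ≤ y - ½ * v
    perturbed-mono⁻ {x} {y} u v s x≤y p q 0≤d = ≤-resp-≈
      (solve 3 (λ x h u → x :+ h :* (:- u) := x :- h :* u) ≈-refl x ½ u)
      (solve 3 (λ x h u → x :+ h :* (:- u) := x :- h :* u) ≈-refl y ½ v)
      (perturbed-mono (- u) (- v) (- s) x≤y (begin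
        - v - - u       ≈⟨ solve 2 (λ u v → :- v :- :- u := :- (v :- u)) ≈-refl u v ⟩
        - (v - u)       ≈⟨ -‿cong p ⟩
        - ((y - x) * s) ≈⟨ solve 2 (λ w s → :- (w :* s) := w :* (:- s)) ≈-refl (y - x) s ⟩
        (y - x) * - s   ∎) q 0≤d)

    -- Spelled as `fromℤ` unfolds, so that these polynomials evaluate definitionally to `α`, `β`,
    -- `γ`.
    :α :β :γ : ∀ {n} → Polynomial n
    :α = #1 :+ #0
    :β = #1 :+ (#1 :+ #0)
    :γ = #1 :+ (#1 :+ (#1 :+ #0))

  -- Serves top rows without a 2, where the cubic would leave the root 2 strictly between a 1 and a
  -- 3.
  quadratic : Carrier → Carrier
  quadratic x = (x - α) * (x - γ)

  cubic : Carrier → Carrier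
  cubic x = (x - α) * (x - β) * (x - γ)

  quadratic-perturbation : Perturbation quadratic
  quadratic-perturbation = record
    { q-cong = λ p → *-cong (+-congʳ p) (+-congʳ p)
    ; mono⁺  = λ {x} {y} α≤x x≤y y≤γ → perturbed-mono (quadratic x) (quadratic y) (x + y - (β + β)) x≤y (slope x y)
        (solve 2 (λ x y → (#1 :+ #1) :* ((#1 :+ #1) :+ (x :+ y :- (:β :+ :β)))
          := (#1 :+ #1) :* ((x :- :α) :+ (y :- :α))) ≈-refl x y)
        (*-nonneg 0≤2 (+-nonneg (x≤y⇒0≤y-x α≤x) (x≤y⇒0≤y-x (≤-trans α≤x x≤y))))
    ; mono⁻  = λ {x} {y} α≤x x≤y y≤γ → perturbed-mono⁻ (quadratic x) (quadratic y) (x + y - (β + β)) x≤y (slope x y)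
        (solve 2 (λ x y → (#1 :+ #1) :* ((#1 :+ #1) :- (x :+ y :- (:β :+ :β)))
          := (#1 :+ #1) :* ((:γ :- x) :+ (:γ :- y))) ≈-refl x y)
        (*-nonneg 0≤2 (+-nonneg (x≤y⇒0≤y-x (≤-trans x≤y y≤γ)) (x≤y⇒0≤y-x y≤γ)))
    }
    where
    0≤2 : 0# ≤ 1# + 1#
    0≤2 = +-nonneg 0≤1 0≤1
    slope : ∀ x y → quadratic y - quadratic x ≈ (y - x) * (x + y - (β + β))
    slope = solve 2 (λ x y → (y :- :α) :* (y :- :γ) :- (x :- :α) :* (x :- :γ)
      := (y :- x) :* (x :+ y :- (:β :+ :β))) ≈-refl

  cubic-perturbation : Perturbation cubic
  cubic-perturbation = record
    { q-cong = λ p → *-cong (*-cong (+-congʳ p) (+-congʳ p)) (+-congʳ p)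
    ; mono⁺  = λ {x} {y} α≤x x≤y y≤γ → perturbed-mono (cubic x) (cubic y) (slope x y) x≤y (slope≈ x y)
        (solve 2 (λ x y → (#1 :+ #1) :* ((#1 :+ #1) :+ :slope x y)
          := (x :- :β) :* (x :- :β) :+ (y :- :β) :* (y :- :β) :+ (x :+ y :- (:β :+ :β)) :* (x :+ y :- (:β :+ :β)) :+ (#1 :+ #1))
          ≈-refl x y)
        (+-nonneg (+-nonneg (+-nonneg (square-nonneg _) (square-nonneg _)) (square-nonneg _)) (+-nonneg 0≤1 0≤1))
    ; mono⁻  = λ {x} {y} α≤x x≤y y≤γ →
        let 0≤x-α = x≤y⇒0≤y-x α≤x
            0≤y-α = x≤y⇒0≤y-x (≤-trans α≤x x≤y)
            0≤γ-x = x≤y⇒0≤y-x (≤-trans x≤y y≤γ)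
            0≤γ-y = x≤y⇒0≤y-x y≤γ
        in perturbed-mono⁻ (cubic x) (cubic y) (slope x y) x≤y (slope≈ x y)
        -- The certificate is a combination of products of the distances from x and y to 1 and 3,
        -- all nonnegative on the interval.
        (solve 2 (λ x y → (#1 :+ #1) :* ((#1 :+ #1) :- :slope x y)
          := (#1 :+ #1) :* ((x :- :α) :* (:γ :- x) :+ (y :- :α) :* (:γ :- y))
             :+ ((:γ :- x) :* (y :- :α) :+ (x :- :α) :* (:γ :- y)))
          ≈-refl x y)
        (+-nonneg (*-nonneg (+-nonneg 0≤1 0≤1) (+-nonneg (*-nonneg 0≤x-α 0≤γ-x) (*-nonneg 0≤y-α 0≤γ-y)))
                  (+-nonneg (*-nonneg 0≤γ-x 0≤y-α) (*-nonneg 0≤x-α 0≤γ-y)))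
    }
    where
    slope : Carrier → Carrier → Carrier
    slope x y = (x - β) * (x - β) + (x - β) * (y - β) + (y - β) * (y - β) - 1#
    :slope : ∀ {n} → Polynomial n → Polynomial n → Polynomial n
    :slope x y = (x :- :β) :* (x :- :β) :+ (x :- :β) :* (y :- :β) :+ (y :- :β) :* (y :- :β) :- #1
    slope≈ : ∀ x y → cubic y - cubic x ≈ (y - x) * slope x y
    slope≈ = solve 2 (λ x y → (y :- :α) :* (y :- :β) :* (y :- :γ) :- (x :- :α) :* (x :- :β) :* (x :- :γ)
      := (y :- x) :* :slope x y) ≈-refl

  -- Apartness from `c` removes the third factor. Cotransitivity of `a # b` at `x` then tells which
  -- of the other two factors is invertible, hence which root `x` is.
  two-roots : ∀ {a b c x} → a # b → x # c → (x - a) * (x - b) * (x - c) ≈ 0# → x ≈ a ⊎ x ≈ b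
  two-roots {a} {b} {c} {x} a#b x#c p with #-cotrans a#b x
  ... | inj₁ a#x = inj₂ (x-y≈0⇒x≈y (*-cancel-# (#-sym a#x) (*-cancel-# x#c (≈-trans
          (solve 3 (λ u v w → w :* (u :* v) := u :* v :* w) ≈-refl (x - a) (x - b) (x - c)) p))))
  ... | inj₂ x#b = inj₁ (x-y≈0⇒x≈y (*-cancel-# x#b (*-cancel-# x#c (≈-trans
          (solve 3 (λ u v w → w :* (v :* u) := u :* v :* w) ≈-refl (x - a) (x - b) (x - c)) p))))

  quadratic-roots : ∀ {x} → quadratic x ≈ 0# → x ≈ α ⊎ x ≈ γ
  quadratic-roots {x} p with #-cotrans (<⇒# α<γ) x
  ... | inj₁ α#x = inj₂ (x-y≈0⇒x≈y (*-cancel-# (#-sym α#x) p))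
  ... | inj₂ x#γ = inj₁ (x-y≈0⇒x≈y (*-cancel-# x#γ (≈-trans (*-comm (x - γ) (x - α)) p)))

  cubic-roots-≤β : ∀ {x} → x ≤ β → cubic x ≈ 0# → x ≈ α ⊎ x ≈ β
  cubic-roots-≤β x≤β = two-roots (<⇒# α<β) (<⇒# (≤-<-trans x≤β β<γ))

  cubic-roots-≥β : ∀ {x} → β ≤ x → cubic x ≈ 0# → x ≈ β ⊎ x ≈ γ
  cubic-roots-≥β {x} β≤x p = two-roots (<⇒# β<γ) (#-sym (<⇒# (<-≤-trans α<β β≤x)))
    (≈-trans (solve 3 (λ u v w → v :* w :* u := u :* v :* w) ≈-refl (x - α) (x - β) (x - γ)) p)

  cubic-α : cubic α ≈ 0#
  cubic-α = solve 0 ((:α :- :α) :* (:α :- :β) :* (:α :- :γ) := #0) ≈-refl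
  cubic-β : cubic β ≈ 0#
  cubic-β = solve 0 ((:β :- :α) :* (:β :- :β) :* (:β :- :γ) := #0) ≈-refl
  cubic-γ : cubic γ ≈ 0#
  cubic-γ = solve 0 ((:γ :- :α) :* (:γ :- :β) :* (:γ :- :γ) := #0) ≈-refl
  quadratic-α : quadratic α ≈ 0#
  quadratic-α = solve 0 ((:α :- :α) :* (:α :- :γ) := #0) ≈-refl
  quadratic-γ : quadratic γ ≈ 0#
  quadratic-γ = solve 0 ((:γ :- :α) :* (:γ :- :γ) := #0) ≈-refl

-- Gelfand–Zetlin patterns

module Patterns {c ℓ₁ ℓ₂ ℓ₃} (K : OrderedField c ℓ₁ ℓ₂ ℓ₃) where

  open OrderedField K
  open OrderedFieldProperties K
  open Perturbations K

  -- The top row becomes a parameter with values in the field: after the removal of a row, the new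
  -- top row is a row of the point and no longer a list of integers.
  Row : ℕ → Set c
  Row n = ∀ j → .(j ℕ.< n) → Carrier

  infix 4 _≈ᴿ_
  _≈ᴿ_ : ∀ {n} → Row n → Row n → Set ℓ₁
  _≈ᴿ_ {n} r s = ∀ j (h : j ℕ.< n) → r j h ≈ s j h

  entryᴿ : ∀ {n} → Row n → Point K n → ∀ i j → .(i ℕ.+ j ℕ.< n) → Carrier
  entryᴿ r u zero    j h = r j h
  entryᴿ r u (suc i) j h = u i j h

  InGZ : ∀ {n} → Row n → Point K n → Set ℓ₃
  InGZ {n} r u = ∀ i j (h : suc i ℕ.+ j ℕ.< n) →
    entryᴿ r u i j (ℕ.<-trans (ℕ.n<1+n (i ℕ.+ j)) h) ≤ entryᴿ r u (suc i) j h
    × entryᴿ r u (suc i) j h ≤ entryᴿ r u i (suc j) (subst (ℕ._< n) (≡.sym (ℕ.+-suc i j)) h)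

  Extreme : ∀ {n} → Row n → Point K n → Set (c ⊔ ℓ₁ ⊔ ℓ₃)
  Extreme r v = InGZ r v ×
    (∀ u w t → InGZ r u → InGZ r w → 0# < t → t < 1# →
     _≈ᴾ_ K v (combination K t u w) → _≈ᴾ_ K u v × _≈ᴾ_ K w v)

  first : ∀ {n} → Point K (suc n) → Row n
  first u j h = u 0 j (s≤s h)

  rest : ∀ {n} → Point K (suc n) → Point K n
  rest u i j h = u (suc i) j (s≤s h)

  infixr 5 _◂_
  _◂_ : ∀ {n} → Row n → Point K n → Point K (suc n)
  (r ◂ u) zero    j h = r j (s<s⁻¹ h)
  (r ◂ u) (suc i) j h = u i j (s<s⁻¹ h)

  Interlaces : ∀ {n} → Row (suc n) → Row n → Set ℓ₃
  Interlaces {n} r s = ∀ j (h : j ℕ.< n) → r j (ℕ.m<n⇒m<1+n h) ≤ s j h × s j h ≤ r (suc j) (s≤s h)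

  entry-resp : ∀ {n} {r s : Row n} {u v : Point K n} → r ≈ᴿ s → _≈ᴾ_ K u v →
    ∀ i j (h : i ℕ.+ j ℕ.< n) → entryᴿ r u i j h ≈ entryᴿ s v i j h
  entry-resp p q zero    j h = p j h
  entry-resp p q (suc i) j h = q i j h

  InGZ-resp : ∀ {n} {r s : Row n} {u v : Point K n} → r ≈ᴿ s → _≈ᴾ_ K u v → InGZ r u → InGZ s v
  InGZ-resp {n} p q g i j h =
      ≤-resp-≈ (entry-resp p q i j (ℕ.<-trans (ℕ.n<1+n (i ℕ.+ j)) h)) (q i j h) (proj₁ (g i j h))
    , ≤-resp-≈ (q i j h) (entry-resp p q i (suc j) (subst (ℕ._< n) (≡.sym (ℕ.+-suc i j)) h)) (proj₂ (g i j h))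

  Extreme-resp : ∀ {n} {r s : Row n} {u v : Point K n} → r ≈ᴿ s → _≈ᴾ_ K u v → Extreme r u → Extreme s v
  Extreme-resp p q (g , e) = InGZ-resp p q g , λ u w t gu gw 0<t t<1 eq →
    map (λ a i j h → ≈-trans (a i j h) (q i j h)) (λ a i j h → ≈-trans (a i j h) (q i j h))
      (e u w t (InGZ-resp (λ j h → ≈-sym (p j h)) (λ _ _ _ → ≈-refl) gu)
               (InGZ-resp (λ j h → ≈-sym (p j h)) (λ _ _ _ → ≈-refl) gw) 0<t t<1
         (λ i j h → ≈-trans (q i j h) (eq i j h)))

  InGZ-first : ∀ {n} {r : Row (suc n)} {u} → InGZ r u → Interlaces r (first u)
  InGZ-first g j h = g 0 j (s≤s h)

  InGZ-rest : ∀ {n} {r : Row (suc n)} {u} → InGZ r u → InGZ (first u) (rest u)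
  InGZ-rest g zero    j h = g 1 j (s≤s h)
  InGZ-rest g (suc i) j h = g (suc (suc i)) j (s≤s h)

  InGZ-◂ : ∀ {n} {r : Row (suc n)} {s u} → Interlaces r s → InGZ s u → InGZ r (s ◂ u)
  InGZ-◂ p g zero          j h = p j (s<s⁻¹ h)
  InGZ-◂ p g (suc zero)    j h = g 0 j (s<s⁻¹ h)
  InGZ-◂ p g (suc (suc i)) j h = g (suc i) j (s<s⁻¹ h)

  ◂-first-rest : ∀ {n} (u : Point K (suc n)) → _≈ᴾ_ K (first u ◂ rest u) u
  ◂-first-rest u zero    j h = ≈-refl
  ◂-first-rest u (suc i) j h = ≈-refl

  -- A segment through `rest v` lifts to one through `v` by keeping the first row of `v` fixed.
  Extreme-rest : ∀ {n} {r : Row (suc n)} {v} → Extreme r v → Extreme (first v) (rest v)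
  Extreme-rest {n} {r} {v} (g , e) = InGZ-rest g , λ u w t gu gw 0<t t<1 eq →
    map (λ a i j h → a (suc i) j (s≤s h)) (λ a i j h → a (suc i) j (s≤s h))
      (e (first v ◂ u) (first v ◂ w) t (InGZ-◂ (InGZ-first g) gu) (InGZ-◂ (InGZ-first g) gw) 0<t t<1
        λ { zero    j h → solve 2 (λ t x → x := t :* x :+ (#1 :- t) :* x) ≈-refl t (first v j (s<s⁻¹ h))
          ; (suc i) j h → eq i j (s<s⁻¹ h) })

  Corner : ∀ {n} → Row (suc n) → Row n → Set ℓ₁
  Corner {n} r s = ∀ j (h : j ℕ.< n) → s j h ≈ r j (ℕ.m<n⇒m<1+n h) ⊎ s j h ≈ r (suc j) (s≤s h)

  Increasing : ∀ {n} → Row (suc n) → Set ℓ₃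
  Increasing {n} r = ∀ j (h : j ℕ.< n) → r j (ℕ.m<n⇒m<1+n h) ≤ r (suc j) (s≤s h)

  corner-interlaces : ∀ {n} {r : Row (suc n)} {s} → Increasing r → Corner r s → Interlaces r s
  corner-interlaces {n} {r} {s} inc corner j h with corner j h
  ... | inj₁ p = ≤-reflexive (≈-sym p) , ≤-resp-≈ (≈-sym p) ≈-refl (inc j h)
  ... | inj₂ p = ≤-resp-≈ ≈-refl (≈-sym p) (inc j h) , ≤-reflexive p

  -- Each coordinate of a corner is an end of the interval allowed to it, and an end of an interval
  -- is extreme there.
  corner-extreme : ∀ {n} {r : Row (suc n)} {s x y : Row n} {t} → Corner r s → Interlaces r x → Interlaces r y →
    0# < t → t < 1# → (∀ j (h : j ℕ.< n) → s j h ≈ t * x j h + (1# - t) * y j h) →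
    ∀ j (h : j ℕ.< n) → x j h ≈ s j h × y j h ≈ s j h
  corner-extreme corner p q 0<t t<1 eq j h with corner j h
  ... | inj₁ e = map (λ a → ≈-trans a (≈-sym e)) (λ a → ≈-trans a (≈-sym e))
    (minimum-extreme 0<t t<1 (proj₁ (p j h)) (proj₁ (q j h)) (≈-trans (≈-sym e) (eq j h)))
  ... | inj₂ e = map (λ a → ≈-trans a (≈-sym e)) (λ a → ≈-trans a (≈-sym e))
    (maximum-extreme 0<t t<1 (proj₂ (p j h)) (proj₂ (q j h)) (≈-trans (≈-sym e) (eq j h)))

  -- Both ends of a segment through `v` have the first row of `v`, by `corner-extreme`. Their
  -- remaining rows thus lie in the polytope below that row, where `rest v` is extreme.
  Extreme-corner : ∀ {n} {r : Row (suc n)} {v} → Increasing r → Corner r (first v) →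
    Extreme (first v) (rest v) → Extreme r v
  Extreme-corner {n} {r} {v} inc corner (g , e) =
      InGZ-resp (λ _ _ → ≈-refl) (◂-first-rest v) (InGZ-◂ (corner-interlaces {r = r} inc corner) g)
    , λ u w t gu gw 0<t t<1 eq →
      let ends = corner-extreme {r = r} {x = first u} {first w} corner (InGZ-first gu) (InGZ-first gw) 0<t t<1 (λ j h → eq 0 j (s≤s h))
          u₁ = λ j (h : j ℕ.< n) → proj₁ (ends j h)
          w₁ = λ j (h : j ℕ.< n) → proj₂ (ends j h)
          rests = e (rest u) (rest w) t
            (InGZ-resp u₁ (λ _ _ _ → ≈-refl) (InGZ-rest gu))
            (InGZ-resp w₁ (λ _ _ _ → ≈-refl) (InGZ-rest gw))
            0<t t<1 (λ i j h → eq (suc i) j (s≤s h))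
      in (λ { zero    j h → u₁ j (s<s⁻¹ h) ; (suc i) j h → proj₁ rests i j (s<s⁻¹ h) })
       , (λ { zero    j h → w₁ j (s<s⁻¹ h) ; (suc i) j h → proj₂ rests i j (s<s⁻¹ h) })

  entry-bounds : ∀ {n} {r : Row n} {u a b} → InGZ r u → (∀ j (h : j ℕ.< n) → a ≤ r j h × r j h ≤ b) →
    ∀ i j (h : i ℕ.+ j ℕ.< n) → a ≤ entryᴿ r u i j h × entryᴿ r u i j h ≤ b
  entry-bounds g p zero    j h = p j h
  entry-bounds {n} g p (suc i) j h =
      ≤-trans (proj₁ (entry-bounds g p i j (ℕ.<-trans (ℕ.n<1+n (i ℕ.+ j)) h))) (proj₁ (g i j h))
    , ≤-trans (proj₂ (g i j h)) (proj₂ (entry-bounds g p i (suc j) (subst (ℕ._< n) (≡.sym (ℕ.+-suc i j)) h)))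

  -- An extreme point v is the midpoint of the images of v under the increasing maps
  -- x ± q x / 2, which fix the top row.
  Extreme-root : ∀ {n} {r : Row n} {v q} → Perturbation q →
    (∀ j (h : j ℕ.< n) → α ≤ r j h × r j h ≤ γ) → (∀ j (h : j ℕ.< n) → q (r j h) ≈ 0#) →
    Extreme r v → ∀ i j (h : suc i ℕ.+ j ℕ.< n) → q (v i j h) ≈ 0#
  Extreme-root {n} {r} {v} {q} perturbation bounds qr≈0 (g , e) i j h = begin
    q (v i j h)
      ≈⟨ *-identityˡ _ ⟨
    1# * q (v i j h)
      ≈⟨ *-congʳ 2*½≈1 ⟨
    (1# + 1#) * ½ * q (v i j h)
      ≈⟨ solve 3 (λ a x h → (#1 :+ #1) :* h :* a := (#1 :+ #1) :* ((x :+ h :* a) :- x)) ≈-refl (q (v i j h)) (v i j h) ½ ⟩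
    (1# + 1#) * (v⁺ i j h - v i j h)
      ≈⟨ *-congˡ (≈-trans (+-congʳ (proj₁ (e v⁺ v⁻ ½ g⁺ g⁻ 0<½ ½<1 midpoint) i j h)) (-‿inverseʳ _)) ⟩
    (1# + 1#) * 0#
      ≈⟨ zeroʳ _ ⟩
    0# ∎
    where
    open import Relation.Binary.Reasoning.Setoid ≈-setoid
    open Perturbation perturbation

    v⁺ v⁻ : Point K n
    v⁺ i j h = v i j h + ½ * q (v i j h)
    v⁻ i j h = v i j h - ½ * q (v i j h)

    entry⁺ : ∀ i j (h : i ℕ.+ j ℕ.< n) → entryᴿ r v i j h + ½ * q (entryᴿ r v i j h) ≈ entryᴿ r v⁺ i j h
    entry⁺ zero    j h = ≈-trans (+-congˡ (≈-trans (*-congˡ (qr≈0 j h)) (zeroʳ ½))) (+-identityʳ _)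
    entry⁺ (suc i) j h = ≈-refl

    entry⁻ : ∀ i j (h : i ℕ.+ j ℕ.< n) → entryᴿ r v i j h - ½ * q (entryᴿ r v i j h) ≈ entryᴿ r v⁻ i j h
    entry⁻ zero    j h = ≈-trans (+-congˡ (-‿cong (≈-trans (*-congˡ (qr≈0 j h)) (zeroʳ ½))))
      (solve 1 (λ x → x :- #0 := x) ≈-refl _)
    entry⁻ (suc i) j h = ≈-refl

    lower : ∀ i j (h : i ℕ.+ j ℕ.< n) → α ≤ entryᴿ r v i j h
    lower i j h = proj₁ (entry-bounds g bounds i j h)

    upper : ∀ i j (h : i ℕ.+ j ℕ.< n) → entryᴿ r v i j h ≤ γ
    upper i j h = proj₂ (entry-bounds g bounds i j h)

    g⁺ : InGZ r v⁺
    g⁺ i j h =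
        ≤-resp-≈ (entry⁺ i j (ℕ.<-trans (ℕ.n<1+n (i ℕ.+ j)) h)) ≈-refl
          (mono⁺ (lower i j (ℕ.<-trans (ℕ.n<1+n (i ℕ.+ j)) h)) (proj₁ (g i j h)) (upper (suc i) j h))
      , ≤-resp-≈ ≈-refl (entry⁺ i (suc j) (subst (ℕ._< n) (≡.sym (ℕ.+-suc i j)) h))
          (mono⁺ (lower (suc i) j h) (proj₂ (g i j h)) (upper i (suc j) (subst (ℕ._< n) (≡.sym (ℕ.+-suc i j)) h)))

    g⁻ : InGZ r v⁻
    g⁻ i j h =
        ≤-resp-≈ (entry⁻ i j (ℕ.<-trans (ℕ.n<1+n (i ℕ.+ j)) h)) ≈-refl
          (mono⁻ (lower i j (ℕ.<-trans (ℕ.n<1+n (i ℕ.+ j)) h)) (proj₁ (g i j h)) (upper (suc i) j h))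
      , ≤-resp-≈ ≈-refl (entry⁻ i (suc j) (subst (ℕ._< n) (≡.sym (ℕ.+-suc i j)) h))
          (mono⁻ (lower (suc i) j h) (proj₂ (g i j h)) (upper i (suc j) (subst (ℕ._< n) (≡.sym (ℕ.+-suc i j)) h)))

    midpoint : _≈ᴾ_ K v (combination K ½ v⁺ v⁻)
    midpoint i j h = ≈-sym (begin
      ½ * v⁺ i j h + (1# - ½) * v⁻ i j h
        ≈⟨ solve 3 (λ h x a → h :* (x :+ h :* a) :+ (#1 :- h) :* (x :- h :* a)
             := x :- h :* a :+ ((#1 :+ #1) :* h) :* (h :* a)) ≈-refl ½ (v i j h) (q (v i j h)) ⟩
      v i j h - ½ * q (v i j h) + ((1# + 1#) * ½) * (½ * q (v i j h))
        ≈⟨ +-congˡ (*-congʳ 2*½≈1) ⟩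
      v i j h - ½ * q (v i j h) + 1# * (½ * q (v i j h))
        ≈⟨ solve 2 (λ x a → x :- a :+ #1 :* a := x) ≈-refl (v i j h) (½ * q (v i j h)) ⟩
      v i j h ∎)

-- Counting

module Enumerations {a ℓ} (S : Setoid a ℓ) where

  open Setoid S

  -- Counting up to `≈` on the carrier keeps the proofs of `P` out of the count, so that logically
  -- equivalent predicates can be exchanged by `relabel`.
  record Enumeration {p} (P : Carrier → Set p) (N : ℕ) : Set (a ⊔ ℓ ⊔ p) where
    field
      element    : Fin N → Carrier
      satisfies  : ∀ i → P (element i)
      injective  : ∀ {i j} → element i ≈ element j → i ≡ j
      surjective : ∀ x → P x → ∃ λ i → element i ≈ x

  open Enumeration

  relabel : ∀ {p q} {P : Carrier → Set p} {Q : Carrier → Set q} {N} →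
    (∀ {x} → P x → Q x) → (∀ {x} → Q x → P x) → Enumeration P N → Enumeration Q N
  relabel f g E = record
    { element    = element E
    ; satisfies  = f ∘ satisfies E
    ; injective  = injective E
    ; surjective = λ x → surjective E x ∘ g
    }

  union : ∀ {p q} {P : Carrier → Set p} {Q : Carrier → Set q} {M N} →
    Enumeration P M → Enumeration Q N → (∀ {x y} → P x → Q y → ¬ x ≈ y) →
    Enumeration (λ x → P x ⊎ Q x) (M ℕ.+ N)
  union {P = P} {Q} {M} {N} D E disjoint = record
    { element    = elt ∘ splitAt M
    ; satisfies  = λ i → sat (splitAt M i)
    ; injective  = λ {i} {j} p → ≡.trans (≡.sym (join-splitAt M N i))
                     (≡.trans (cong (join M N) (inj (splitAt M i) (splitAt M j) p)) (join-splitAt M N j))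
    ; surjective = sur
    }
    where
    elt : Fin M ⊎ Fin N → Carrier
    elt = [ element D , element E ]
    sat : ∀ i → P (elt i) ⊎ Q (elt i)
    sat (inj₁ i) = inj₁ (satisfies D i)
    sat (inj₂ i) = inj₂ (satisfies E i)
    inj : ∀ i j → elt i ≈ elt j → i ≡ j
    inj (inj₁ i) (inj₁ j) p = cong inj₁ (injective D p)
    inj (inj₂ i) (inj₂ j) p = cong inj₂ (injective E p)
    inj (inj₁ i) (inj₂ j) p = contradiction p (disjoint (satisfies D i) (satisfies E j))
    inj (inj₂ i) (inj₁ j) p = contradiction (sym p) (disjoint (satisfies D j) (satisfies E i))
    sur : ∀ x → P x ⊎ Q x → ∃ λ i → elt (splitAt M i) ≈ x
    sur x (inj₁ p) with surjective D x p
    ... | i , q = i ↑ˡ N , trans (reflexive (cong elt (splitAt-↑ˡ M i N))) q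
    sur x (inj₂ p) with surjective E x p
    ... | i , q = M ↑ʳ i , trans (reflexive (cong elt (splitAt-↑ʳ M N i))) q

module _ {a b ℓ ℓ′} (S : Setoid a ℓ) (T : Setoid b ℓ′) where

  private
    module S = Setoid S
    module T = Setoid T
    module ES = Enumerations S
    module ET = Enumerations T
  open ES.Enumeration

  transport : ∀ {p q} {P : S.Carrier → Set p} {Q : T.Carrier → Set q} {N} (f : S.Carrier → T.Carrier) →
    (∀ {x y} → x S.≈ y → f x T.≈ f y) → (∀ {x y} → f x T.≈ f y → x S.≈ y) →
    (∀ {x} → P x → Q (f x)) → (∀ {y} → Q y → ∃ λ x → P x × f x T.≈ y) →
    ES.Enumeration P N → ET.Enumeration Q N
  transport f f-cong f-injective f-image f-preimage E = record
    { element    = f ∘ element E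
    ; satisfies  = f-image ∘ satisfies E
    ; injective  = injective E ∘ f-injective
    ; surjective = λ y q →
        let x , p , fx≈y = f-preimage q
            i , e≈x      = surjective E x p
        in i , T.trans (f-cong e≈x) fx≈y
    }

-- The summands are ordered and bracketed like the disjoint unions in `enumerate`. The recursion is
-- well founded although the last summand raises the middle argument, because the first one drops
-- there.
V : ℕ → ℕ → ℕ → ℕ
V zero    zero    zero    = 1
V zero    zero    (suc m) = V 0 0 m
V zero    (suc l) zero    = V 0 l 0
V zero    (suc l) (suc m) = V 0 l (suc m) ℕ.+ V 0 (suc l) m
V (suc k) zero    zero    = V k 0 0
V (suc k) zero    (suc m) = V k 0 (suc m) ℕ.+ V (suc k) 0 m
V (suc k) (suc l) zero    = V (suc k) l 0 ℕ.+ V k (suc l) 0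
V (suc k) (suc l) (suc m) =
  V (suc k) l (suc m) ℕ.+ V k (suc l) (suc m) ℕ.+ V (suc k) (suc l) m ℕ.+ V k (suc (suc l)) m

-- The top row 1^k 2^l 3^m, continued by 3s.
row : ℕ → ℕ → ℕ → ℤ
row (suc k) l       zero    = + 1
row (suc k) l       (suc j) = row k l j
row zero    (suc l) zero    = + 2
row zero    (suc l) (suc j) = row zero l j
row zero    zero    j       = + 3

row-last₁ : ∀ k l → row (suc k) l k ≡ + 1
row-last₁ zero    l = ≡.refl
row-last₁ (suc k) l = row-last₁ k l

row-first₂ : ∀ k l → row k (suc l) k ≡ + 2
row-first₂ zero    l = ≡.refl
row-first₂ (suc k) l = row-first₂ k l

row-last₂ : ∀ k l → row k (suc l) (k ℕ.+ l) ≡ + 2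
row-last₂ (suc k) l       = row-last₂ k l
row-last₂ zero    zero    = ≡.refl
row-last₂ zero    (suc l) = row-last₂ zero l

row-first₃ : ∀ k l → row k l (k ℕ.+ l) ≡ + 3
row-first₃ (suc k) l       = row-first₃ k l
row-first₃ zero    zero    = ≡.refl
row-first₃ zero    (suc l) = row-first₃ zero l

-- The last 2 of the longer block sits at position `k + l`. When no 3s are present this identifies
-- corners that differ only beyond the end of the row.
row-truncate : ∀ k l j → j ℕ.< k ℕ.+ l → row k (suc l) j ≡ row k l j
row-truncate (suc k) l       zero    _       = ≡.refl
row-truncate (suc k) l       (suc j) (s≤s h) = row-truncate k l j h
row-truncate zero    (suc l) zero    _       = ≡.refl
row-truncate zero    (suc l) (suc j) (s≤s h) = row-truncate zero l j h

row-truncate₀ : ∀ k j → j ℕ.< k → row (suc k) 0 j ≡ row k 0 j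
row-truncate₀ (suc k) zero    _       = ≡.refl
row-truncate₀ (suc k) (suc j) (s≤s h) = row-truncate₀ k j h

-- Stated for infinite rows, hence independent of the number of 3s. Left and right end differ only
-- where the letter changes; the suffix of the lemmas below lists the letters at whose last place
-- the right end is taken, so `corner-1` turns the last 1 into a 2 and otherwise keeps the left
-- ends.
_,_CornerOf_,_ : ℕ → ℕ → ℕ → ℕ → Set
k′ , l′ CornerOf k , l = ∀ j → row k′ l′ j ≡ row k l j ⊎ row k′ l′ j ≡ row k l (suc j)

corner-self : ∀ k l → k , l CornerOf k , l
corner-self k l j = inj₁ ≡.refl

corner-12 : ∀ k l → k , l CornerOf suc k , l
corner-12 k l j = inj₂ ≡.refl

corner-2 : ∀ k l → k , l CornerOf k , suc l
corner-2 zero    l j       = inj₂ ≡.refl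
corner-2 (suc k) l zero    = inj₁ ≡.refl
corner-2 (suc k) l (suc j) = corner-2 k l j

corner-1 : ∀ k l → k , suc (suc l) CornerOf suc k , suc l
corner-1 zero    l zero    = inj₂ ≡.refl
corner-1 zero    l (suc j) = inj₁ ≡.refl
corner-1 (suc k) l zero    = inj₁ ≡.refl
corner-1 (suc k) l (suc j) = corner-1 k l j

-- Corner rows of 1^k 2^l 3^m and the count of vertices

module Vertices {c ℓ₁ ℓ₂ ℓ₃} (K : OrderedField c ℓ₁ ℓ₂ ℓ₃) where

  open OrderedField K hiding (zero)
  open OrderedFieldProperties K
  open Perturbations K
  open Patterns K

  top : ∀ {n} → ℕ → ℕ → Row n
  top k l j _ = fromℤ (row k l j)

  row-increasing : ∀ k l j → fromℤ (row k l j) ≤ fromℤ (row k l (suc j))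
  row-bounds : ∀ k l j → α ≤ fromℤ (row k l j) × fromℤ (row k l j) ≤ γ
  row-bounds (suc k) l       zero    = ≤-refl , <⇒≤ α<γ
  row-bounds (suc k) l       (suc j) = row-bounds k l j
  row-bounds zero    (suc l) zero    = <⇒≤ α<β , <⇒≤ β<γ
  row-bounds zero    (suc l) (suc j) = row-bounds zero l j
  row-bounds zero    zero    j       = <⇒≤ α<γ , ≤-refl
  row-increasing (suc k)       l             (suc j) = row-increasing k l j
  row-increasing (suc k)       l             zero    = proj₁ (row-bounds k l 0)
  row-increasing zero          (suc l)       (suc j) = row-increasing zero l j
  row-increasing zero          (suc (suc l)) zero    = ≤-refl
  row-increasing zero          (suc zero)    zero    = <⇒≤ β<γ
  row-increasing zero          zero          j       = ≤-refl

  row-cubic : ∀ k l j → cubic (fromℤ (row k l j)) ≈ 0#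
  row-cubic (suc k) l       zero    = cubic-α
  row-cubic (suc k) l       (suc j) = row-cubic k l j
  row-cubic zero    (suc l) zero    = cubic-β
  row-cubic zero    (suc l) (suc j) = row-cubic zero l j
  row-cubic zero    zero    j       = cubic-γ

  row-quadratic : ∀ k j → quadratic (fromℤ (row k 0 j)) ≈ 0#
  row-quadratic (suc k) zero    = quadratic-α
  row-quadratic (suc k) (suc j) = row-quadratic k j
  row-quadratic zero    j       = quadratic-γ

  private
    Between AtEnd : ℕ → ℕ → ℕ → Carrier → Set _
    Between k l j x = fromℤ (row k l j) ≤ x × x ≤ fromℤ (row k l (suc j))
    AtEnd   k l j x = x ≈ fromℤ (row k l j) ⊎ x ≈ fromℤ (row k l (suc j))

    pinned : ∀ {a x} {B : Set ℓ₁} → a ≤ x × x ≤ a → x ≈ a ⊎ B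
    pinned (a≤x , x≤a) = inj₁ (≤-antisym x≤a a≤x)

  cubic-ends₂ : ∀ l j {x} → Between 0 l j x → cubic x ≈ 0# → AtEnd 0 l j x
  cubic-ends₂ zero          j       p q = pinned p
  cubic-ends₂ (suc l)       (suc j) p q = cubic-ends₂ l j p q
  cubic-ends₂ (suc zero)    zero    p q = cubic-roots-≥β (proj₁ p) q
  cubic-ends₂ (suc (suc l)) zero    p q = pinned p

  -- With at least one 2 in the row, neighbours are equal or consecutive integers. Equal ones pin
  -- `x`; between consecutive ones the third root of the cubic is out of reach.
  cubic-ends : ∀ k l j {x} → Between k (suc l) j x → cubic x ≈ 0# → AtEnd k (suc l) j x
  cubic-ends zero          l j       p q = cubic-ends₂ (suc l) j p q
  cubic-ends (suc k)       l (suc j) p q = cubic-ends k l j p q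
  cubic-ends (suc zero)    l zero    p q = cubic-roots-≤β (proj₂ p) q
  cubic-ends (suc (suc k)) l zero    p q = pinned p

  quadratic-ends : ∀ k j {x} → Between k 0 j x → quadratic x ≈ 0# → AtEnd k 0 j x
  quadratic-ends zero          j       p q = pinned p
  quadratic-ends (suc k)       (suc j) p q = quadratic-ends k j p q
  quadratic-ends (suc zero)    zero    p q = quadratic-roots q
  quadratic-ends (suc (suc k)) zero    p q = pinned p

  Extreme-first : ∀ {n} k l {v : Point K (suc n)} → Extreme (top k l) v → Corner (top k l) (first v)
  Extreme-first k zero {v} E j h = quadratic-ends k j (InGZ-first (proj₁ E) j h)
    (Extreme-root {v = v} quadratic-perturbation (λ j _ → row-bounds k 0 j) (λ j _ → row-quadratic k j) E 0 j (s≤s h))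
  Extreme-first k (suc l) {v} E j h = cubic-ends k l j (InGZ-first (proj₁ E) j h)
    (Extreme-root {v = v} cubic-perturbation (λ j _ → row-bounds k (suc l) j) (λ j _ → row-cubic k (suc l) j) E 0 j (s≤s h))

  corner-33 : ∀ {n} {s : Row n} → Corner (top 0 0) s → s ≈ᴿ top 0 0
  corner-33 p j h = [ id , id ] (p j h)

  private
    shifted : ∀ {n} → Row (suc n) → Row n
    shifted s j h = s (suc j) (s≤s h)

    prepend : ∀ {n} {s : Row (suc n)} k l → s 0 (s≤s z≤n) ≈ fromℤ (row k l 0) →
      (∀ j (h : j ℕ.< n) → s (suc j) (s≤s h) ≈ fromℤ (row k l (suc j))) → s ≈ᴿ top k l
    prepend k l p q zero    h       = p
    prepend k l p q (suc j) (s≤s h) = q j h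

    idem : ∀ {A : Set ℓ₁} → A ⊎ A → A
    idem = [ id , id ]

  corner-23 : ∀ {n} l {s : Row n} → Corner (top 0 (suc l)) s → s ≈ᴿ top 0 l ⊎ s ≈ᴿ top 0 (suc l)
  -- An empty row satisfies both alternatives, so the choice is arbitrary; on short rows the
  -- alternatives may overlap.
  corner-23 {zero}  l       p = inj₁ λ _ ()
  corner-23 {suc n} zero {s} p with p 0 (s≤s z≤n)
  ... | inj₁ e = inj₂ (prepend 0 1 e λ j h → idem (p (suc j) (s≤s h)))
  ... | inj₂ e = inj₁ (prepend 0 0 e λ j h → idem (p (suc j) (s≤s h)))
  corner-23 {suc n} (suc l) {s} p = map⊎ (prepend 0 (suc l) e) (prepend 0 (suc (suc l)) e)
    (corner-23 l {shifted s} λ j h → p (suc j) (s≤s h))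
    where e = idem (p 0 (s≤s z≤n))

  corner-13 : ∀ {n} k {s : Row n} → Corner (top (suc k) 0) s → s ≈ᴿ top k 0 ⊎ s ≈ᴿ top (suc k) 0
  corner-13 {zero}  k    p = inj₁ λ _ ()
  corner-13 {suc n} zero p with p 0 (s≤s z≤n)
  ... | inj₁ e = inj₂ (prepend 1 0 e λ j h → idem (p (suc j) (s≤s h)))
  ... | inj₂ e = inj₁ (prepend 0 0 e λ j h → idem (p (suc j) (s≤s h)))
  corner-13 {suc n} (suc k) {s} p = map⊎ (prepend (suc k) 0 e) (prepend (suc (suc k)) 0 e)
    (corner-13 k {shifted s} λ j h → p (suc j) (s≤s h))
    where e = idem (p 0 (s≤s z≤n))

  corner-123 : ∀ {n} k l {s : Row n} → Corner (top (suc k) (suc l)) s →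
    ((s ≈ᴿ top (suc k) l ⊎ s ≈ᴿ top k (suc l)) ⊎ s ≈ᴿ top (suc k) (suc l)) ⊎ s ≈ᴿ top k (suc (suc l))
  corner-123 {zero}  k    l p = inj₂ λ _ ()
  corner-123 {suc n} zero l {s} p with p 0 (s≤s z≤n) | corner-23 l {shifted s} (λ j h → p (suc j) (s≤s h))
  ... | inj₁ e | inj₁ q = inj₁ (inj₁ (inj₁ (prepend 1 l e q)))
  ... | inj₁ e | inj₂ q = inj₁ (inj₂ (prepend 1 (suc l) e q))
  ... | inj₂ e | inj₁ q = inj₁ (inj₁ (inj₂ (prepend 0 (suc l) e q)))
  ... | inj₂ e | inj₂ q = inj₂ (prepend 0 (suc (suc l)) e q)
  corner-123 {suc n} (suc k) l {s} p =
    map⊎ (map⊎ (map⊎ (prepend (suc (suc k)) l e) (prepend (suc k) (suc l) e)) (prepend (suc (suc k)) (suc l) e))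
      (prepend (suc k) (suc (suc l)) e)
      (corner-123 k l {shifted s} λ j h → p (suc j) (s≤s h))
    where e = idem (p 0 (s≤s z≤n))

  pointSetoid : ℕ → Setoid c ℓ₁
  pointSetoid n = record
    { Carrier       = Point K n
    ; _≈_           = _≈ᴾ_ K
    ; isEquivalence = record
      { refl  = λ _ _ _ → ≈-refl
      ; sym   = λ e i j h → ≈-sym (e i j h)
      ; trans = λ e f i j h → ≈-trans (e i j h) (f i j h)
      }
    }

  open module E {n} = Enumerations (pointSetoid n)

  record Below {n} (k l : ℕ) (v : Point K (suc n)) : Set (c ⊔ ℓ₁ ⊔ ℓ₃) where
    constructor _,_
    field
      first≈       : first v ≈ᴿ top k l
      rest-extreme : Extreme (top k l) (rest v)

  below : ∀ {n} k l {N} → Enumeration {n} (Extreme (top k l)) N → Enumeration {suc n} (Below k l) N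
  below {n} k l = transport (pointSetoid n) (pointSetoid (suc n)) (top k l ◂_)
    (λ { e zero j h → ≈-refl ; e (suc i) j h → e i j (s<s⁻¹ h) })
    (λ e i j h → e (suc i) j (s≤s h))
    (λ E → (λ _ _ → ≈-refl) , E)
    (λ { {v} (p , E) → rest v , E , λ { zero j h → ≈-sym (p j (s<s⁻¹ h)) ; (suc i) j h → ≈-refl } })

  Extreme⇒Below : ∀ {n} {r : Row (suc n)} k l {v} → Extreme r v → first v ≈ᴿ top k l → Below k l v
  Extreme⇒Below k l E p = p , Extreme-resp p (λ _ _ _ → ≈-refl) (Extreme-rest E)

  Below⇒Extreme : ∀ {n} k l k′ l′ {v : Point K (suc n)} → k′ , l′ CornerOf k , l →
    Below k′ l′ v → Extreme (top k l) v
  Below⇒Extreme k l k′ l′ {v} corner (p , E) = Extreme-corner (λ j _ → row-increasing k l j)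
    (λ j h → map⊎ (λ e → ≈-trans (p j h) (reflexive′ e)) (λ e → ≈-trans (p j h) (reflexive′ e)) (corner j))
    (Extreme-resp (λ j h → ≈-sym (p j h)) (λ _ _ _ → ≈-refl) E)
    where
    reflexive′ : ∀ {a b} → a ≡ b → fromℤ a ≈ fromℤ b
    reflexive′ ≡.refl = ≈-refl

  -- In its uses `j` is a place where the letter of the top row changes and the two corners made
  -- different choices. It has to lie inside the row, which is where a nonempty later block is used.
  Below-disjoint : ∀ {n k l k′ l′ a b} j → j ℕ.< n → row k l j ≡ a → row k′ l′ j ≡ b → ¬ fromℤ a ≈ fromℤ b →
    ∀ {u v : Point K (suc n)} → Below k l u → Below k′ l′ v → ¬ _≈ᴾ_ K u v
  Below-disjoint j h ≡.refl ≡.refl a≉b (p , _) (q , _) u≈v =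
    a≉b (≈-trans (≈-sym (p j h)) (≈-trans (u≈v 0 j (s≤s h)) (q j h)))

  α≉β : ¬ α ≈ β
  α≉β e = <.irrefl e α<β
  β≉α : ¬ β ≈ α
  β≉α e = <.irrefl (≈-sym e) α<β
  γ≉α : ¬ γ ≈ α
  γ≉α e = <.irrefl (≈-sym e) α<γ
  γ≉β : ¬ γ ≈ β
  γ≉β e = <.irrefl (≈-sym e) β<γ

  ≈ᴿ-top : ∀ {n} k l k′ l′ {s : Row n} → (∀ j → j ℕ.< n → row k l j ≡ row k′ l′ j) → s ≈ᴿ top k l → s ≈ᴿ top k′ l′
  ≈ᴿ-top k l k′ l′ e p j h = subst (λ z → _ ≈ fromℤ z) (e j h) (p j h)

  -- Keeping `n` apart from `k + l + m` makes the types of all recursive calls agree on the row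
  -- length, whatever form the sum takes; the recursion then descends on `n`.
  enumerate : ∀ n k l m → n ≡ k ℕ.+ l ℕ.+ m → Enumeration {n} (Extreme (top k l)) (V k l m)
  enumerate zero zero zero zero eq = record
    { element    = λ _ _ _ ()
    ; satisfies  = λ _ → (λ _ _ ()) , λ _ _ _ _ _ _ _ _ → (λ _ _ ()) , λ _ _ ()
    ; injective  = λ { {zero} {zero} _ → ≡.refl }
    ; surjective = λ _ _ → zero , λ _ _ ()
    }
  enumerate (suc n) zero zero (suc m) eq = relabel
    (Below⇒Extreme 0 0 0 0 (corner-self 0 0))
    (λ E → Extreme⇒Below 0 0 E (corner-33 (Extreme-first 0 0 E)))
    (below 0 0 (enumerate n 0 0 m (ℕ.suc-injective eq)))
  enumerate (suc n) zero (suc l) zero eq = relabel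
    (Below⇒Extreme 0 (suc l) 0 l (corner-2 0 l))
    (λ E → Extreme⇒Below 0 l E ([ id , ≈ᴿ-top 0 (suc l) 0 l (λ j h → row-truncate 0 l j (ℕ.<-≤-trans h (ℕ.≤-reflexive n≡l))) ]
      (corner-23 l (Extreme-first 0 (suc l) E))))
    (below 0 l (enumerate n 0 l 0 (ℕ.suc-injective eq)))
    where
    n≡l : n ≡ l
    n≡l = ≡.trans (ℕ.suc-injective eq) (ℕ.+-identityʳ l)
  enumerate (suc n) zero (suc l) (suc m) eq = relabel
    [ Below⇒Extreme 0 (suc l) 0 l (corner-2 0 l) , Below⇒Extreme 0 (suc l) 0 (suc l) (corner-self 0 (suc l)) ]
    (λ E → map⊎ (Extreme⇒Below 0 l E) (Extreme⇒Below 0 (suc l) E) (corner-23 l (Extreme-first 0 (suc l) E)))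
    (union (below 0 l (enumerate n 0 l (suc m) n≡))
           (below 0 (suc l) (enumerate n 0 (suc l) m (≡.trans n≡ (ℕ.+-suc l m))))
           (Below-disjoint l l<n (row-first₃ 0 l) (row-last₂ 0 l) γ≉β))
    where
    n≡ : n ≡ l ℕ.+ suc m
    n≡ = ℕ.suc-injective eq
    l<n : l ℕ.< n
    l<n = subst (l ℕ.<_) (≡.sym n≡) (ℕ.m<m+n l (s≤s z≤n))
  enumerate (suc n) (suc k) zero zero eq = relabel
    (Below⇒Extreme (suc k) 0 k 0 (corner-12 k 0))
    (λ E → Extreme⇒Below k 0 E ([ id , ≈ᴿ-top (suc k) 0 k 0 (λ j h → row-truncate₀ k j (ℕ.<-≤-trans h (ℕ.≤-reflexive n≡k))) ]
      (corner-13 k (Extreme-first (suc k) 0 E))))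
    (below k 0 (enumerate n k 0 0 (ℕ.suc-injective eq)))
    where
    n≡k : n ≡ k
    n≡k = ≡.trans (ℕ.suc-injective eq) (≡.trans (ℕ.+-identityʳ (k ℕ.+ 0)) (ℕ.+-identityʳ k))
  enumerate (suc n) (suc k) zero (suc m) eq = relabel
    [ Below⇒Extreme (suc k) 0 k 0 (corner-12 k 0) , Below⇒Extreme (suc k) 0 (suc k) 0 (corner-self (suc k) 0) ]
    (λ E → map⊎ (Extreme⇒Below k 0 E) (Extreme⇒Below (suc k) 0 E) (corner-13 k (Extreme-first (suc k) 0 E)))
    (union (below k 0 (enumerate n k 0 (suc m) n≡))
           (below (suc k) 0 (enumerate n (suc k) 0 m (≡.trans n≡ (ℕ.+-suc (k ℕ.+ 0) m))))
           (Below-disjoint k k<n (subst (λ j → row k 0 j ≡ + 3) (ℕ.+-identityʳ k) (row-first₃ k 0)) (row-last₁ k 0) γ≉α))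
    where
    n≡ : n ≡ k ℕ.+ 0 ℕ.+ suc m
    n≡ = ℕ.suc-injective eq
    k<n : k ℕ.< n
    k<n = subst (k ℕ.<_) (≡.sym (≡.trans n≡ (cong (ℕ._+ suc m) (ℕ.+-identityʳ k)))) (ℕ.m<m+n k (s≤s z≤n))
  enumerate (suc n) (suc k) (suc l) zero eq = relabel
    [ Below⇒Extreme (suc k) (suc l) (suc k) l (corner-2 (suc k) l)
    , Below⇒Extreme (suc k) (suc l) k (suc l) (corner-12 k (suc l)) ]
    (λ E → map⊎ (Extreme⇒Below (suc k) l E) (Extreme⇒Below k (suc l) E)
      (truncate (corner-123 k l (Extreme-first (suc k) (suc l) E))))
    (union (below (suc k) l (enumerate n (suc k) l 0 (≡.trans n≡ (cong (ℕ._+ 0) (ℕ.+-suc k l)))))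
           (below k (suc l) (enumerate n k (suc l) 0 n≡))
           (Below-disjoint k k<n (row-last₁ k l) (row-first₂ k l) α≉β))
    where
    n≡ : n ≡ k ℕ.+ suc l ℕ.+ 0
    n≡ = ℕ.suc-injective eq
    n≡k+1+l : n ≡ k ℕ.+ suc l
    n≡k+1+l = ≡.trans n≡ (ℕ.+-identityʳ _)
    k<n : k ℕ.< n
    k<n = subst (k ℕ.<_) (≡.sym n≡k+1+l) (ℕ.m<m+n k (s≤s z≤n))
    -- Without 3s the choice between 2 and 3 falls just beyond the end of the row, so the four
    -- alternatives collapse to two.
    truncate : ∀ {s : Row n} →
      ((s ≈ᴿ top (suc k) l ⊎ s ≈ᴿ top k (suc l)) ⊎ s ≈ᴿ top (suc k) (suc l)) ⊎ s ≈ᴿ top k (suc (suc l)) →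
      s ≈ᴿ top (suc k) l ⊎ s ≈ᴿ top k (suc l)
    truncate (inj₁ (inj₁ p)) = p
    truncate (inj₁ (inj₂ p)) = inj₁ (≈ᴿ-top (suc k) (suc l) (suc k) l
      (λ j h → row-truncate (suc k) l j (ℕ.<-≤-trans h (ℕ.≤-reflexive (≡.trans n≡k+1+l (ℕ.+-suc k l))))) p)
    truncate (inj₂ p) = inj₂ (≈ᴿ-top k (suc (suc l)) k (suc l)
      (λ j h → row-truncate k (suc l) j (ℕ.<-≤-trans h (ℕ.≤-reflexive n≡k+1+l))) p)
  enumerate (suc n) (suc k) (suc l) (suc m) eq = relabel
    [ [ [ Below⇒Extreme (suc k) (suc l) (suc k) l (corner-2 (suc k) l)
        , Below⇒Extreme (suc k) (suc l) k (suc l) (corner-12 k (suc l)) ]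
      , Below⇒Extreme (suc k) (suc l) (suc k) (suc l) (corner-self (suc k) (suc l)) ]
    , Below⇒Extreme (suc k) (suc l) k (suc (suc l)) (corner-1 k l) ]
    (λ E → map⊎ (map⊎ (map⊎ (Extreme⇒Below (suc k) l E) (Extreme⇒Below k (suc l) E))
        (Extreme⇒Below (suc k) (suc l) E)) (Extreme⇒Below k (suc (suc l)) E)
      (corner-123 k l (Extreme-first (suc k) (suc l) E)))
    (union
      (union
        (union
          (below (suc k) l (enumerate n (suc k) l (suc m) (≡.trans n≡ (cong (ℕ._+ suc m) (ℕ.+-suc k l)))))
          (below k (suc l) (enumerate n k (suc l) (suc m) n≡))
          (Below-disjoint k k<n (row-last₁ k l) (row-first₂ k l) α≉β))
        (below (suc k) (suc l) (enumerate n (suc k) (suc l) m (≡.trans n≡ (ℕ.+-suc (k ℕ.+ suc l) m))))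
        [ Below-disjoint (suc k ℕ.+ l) 1+k+l<n (row-first₃ (suc k) l) (row-last₂ (suc k) l) γ≉β
        , Below-disjoint k k<n (row-first₂ k l) (row-last₁ k (suc l)) β≉α ])
      (below k (suc (suc l)) (enumerate n k (suc (suc l)) m
        (≡.trans n≡ (≡.trans (ℕ.+-suc (k ℕ.+ suc l) m) (cong (ℕ._+ m) (≡.sym (ℕ.+-suc k (suc l))))))))
      [ [ Below-disjoint k k<n (row-last₁ k l) (row-first₂ k (suc l)) α≉β
        , Below-disjoint (k ℕ.+ suc l) k+1+l<n (row-first₃ k (suc l)) (row-last₂ k (suc l)) γ≉β ]
      , Below-disjoint k k<n (row-last₁ k (suc l)) (row-first₂ k (suc l)) α≉β ])
    where
    n≡ : n ≡ k ℕ.+ suc l ℕ.+ suc m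
    n≡ = ℕ.suc-injective eq
    k+1+l<n : k ℕ.+ suc l ℕ.< n
    k+1+l<n = subst (k ℕ.+ suc l ℕ.<_) (≡.sym n≡) (ℕ.m<m+n (k ℕ.+ suc l) (s≤s z≤n))
    1+k+l<n : suc k ℕ.+ l ℕ.< n
    1+k+l<n = subst (ℕ._< n) (ℕ.+-suc k l) k+1+l<n
    k<n : k ℕ.< n
    k<n = ℕ.≤-<-trans (ℕ.m≤m+n k (suc l)) k+1+l<n

-- The generating function

open ≡ using (refl; sym; trans)
open import Algebra.Properties.Monoid.Sum ℚ.+-0-monoid using (sum⁺-syntax; sum-cong-≗)

-- The ring of series in x, y, z as iterated power series

module ℚ[z]   = PowerSeries ℚ.+-*-commutativeRing
module ℚ[yz]  = PowerSeries ℚ[z].commutativeRing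
module ℚ[xyz] = PowerSeries ℚ[yz].commutativeRing

module _ {c ℓ} (R : CommutativeRing c ℓ) where

  private
    module R = CommutativeRing R
    module R[x] = CommutativeRing (PowerSeries.commutativeRing R)
  open import Algebra.Properties.Monoid.Sum R.+-monoid using (sum)
  open import Algebra.Properties.Monoid.Sum R[x].+-monoid using () renaming (sum to sumˣ)

  sum-coefficient : ∀ n (t : Fin n → ℕ → R.Carrier) i → sumˣ t i R.≈ sum (λ a → t a i)
  sum-coefficient zero    t i = R.refl
  sum-coefficient (suc n) t i = R.+-congˡ (sum-coefficient n (λ a → t (suc a)) i)

-- The nested sums are recognised from the inside out as products in z, then y, then x. The iterated
-- ring has `Series` as its carrier definitionally, so its laws become available for `_*ˢ_`.
*ˢ-⊛ : ∀ f g → f *ˢ g ≈ˢ f ℚ[xyz].⊛ g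
*ˢ-⊛ f g k l m = begin
  (f *ˢ g) k l m
    ≡⟨ sum-cong-≗ {suc k} (λ a → sum-cong-≗ {suc l} λ b → ℚ[z].⊛-sum (f (toℕ a) (toℕ b)) (g (k ∸ toℕ a) (l ∸ toℕ b)) m) ⟩
  ∑[ a ≤ k ] ∑[ b ≤ l ] (f (toℕ a) (toℕ b) ℚ[z].⊛ g (k ∸ toℕ a) (l ∸ toℕ b)) m
    ≡⟨ sum-cong-≗ {suc k} (λ a → trans
         (sym (sum-coefficient ℚ.+-*-commutativeRing (suc l) (λ b → f (toℕ a) (toℕ b) ℚ[z].⊛ g (k ∸ toℕ a) (l ∸ toℕ b)) m))
         (ℚ[yz].⊛-sum (f (toℕ a)) (g (k ∸ toℕ a)) l m)) ⟩
  ∑[ a ≤ k ] (f (toℕ a) ℚ[yz].⊛ g (k ∸ toℕ a)) l m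
    ≡⟨ sum-coefficient ℚ.+-*-commutativeRing (suc k) (λ a → (f (toℕ a) ℚ[yz].⊛ g (k ∸ toℕ a)) l) m ⟨
  _
    ≡⟨ sum-coefficient ℚ[z].commutativeRing (suc k) (λ a → f (toℕ a) ℚ[yz].⊛ g (k ∸ toℕ a)) l m ⟨
  _
    ≡⟨ ℚ[xyz].⊛-sum f g k l m ⟩
  (f ℚ[xyz].⊛ g) k l m ∎
  where open ≡.≡-Reasoning

private module S = CommutativeRing ℚ[xyz].commutativeRing

𝟏-⊛ : 𝟏 ≈ˢ S.1#
𝟏-⊛ zero    zero    zero    = refl
𝟏-⊛ zero    zero    (suc _) = refl
𝟏-⊛ zero    (suc _) _       = refl
𝟏-⊛ (suc _) _       _       = refl

-- The iterated ring with `_*ˢ_` and `𝟏` in place of its own product and unit, so that the ring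
-- identities of `KernelMethod` specialise to the literal expressions of the closed form.
seriesRing : CommutativeRing _ _
seriesRing = record
  { Carrier = Series
  ; _≈_     = _≈ˢ_
  ; _+_     = _+ˢ_
  ; _*_     = _*ˢ_
  ; -_      = S.-_
  ; 0#      = S.0#
  ; 1#      = 𝟏
  ; isCommutativeRing = record
    { isRing = record
      { +-isAbelianGroup = S.+-isAbelianGroup
      ; *-cong = *-cong
      ; *-assoc = λ f g h → begin
          (f *ˢ g) *ˢ h ≈⟨ *ˢ-⊛ (f *ˢ g) h ⟩
          (f *ˢ g) S.* h ≈⟨ S.*-congʳ {h} {f *ˢ g} {f S.* g} (*ˢ-⊛ f g) ⟩
          (f S.* g) S.* h ≈⟨ S.*-assoc f g h ⟩
          f S.* (g S.* h) ≈⟨ S.*-congˡ {f} {g *ˢ h} {g S.* h} (*ˢ-⊛ g h) ⟨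
          f S.* (g *ˢ h) ≈⟨ *ˢ-⊛ f (g *ˢ h) ⟨
          f *ˢ (g *ˢ h) ∎
      ; *-identity = identityˡ , λ f → S.trans {f *ˢ 𝟏} {𝟏 *ˢ f} {f} (comm f 𝟏) (identityˡ f)
      ; distrib = (λ f g h → begin
          f *ˢ (g +ˢ h)      ≈⟨ comm f (g +ˢ h) ⟩
          (g +ˢ h) *ˢ f      ≈⟨ distribʳ f g h ⟩
          g *ˢ f +ˢ h *ˢ f   ≈⟨ S.+-cong {g *ˢ f} {f *ˢ g} {h *ˢ f} {f *ˢ h} (comm g f) (comm h f) ⟩
          f *ˢ g +ˢ f *ˢ h   ∎)
        , distribʳ
      }
    ; *-comm = comm
    }
  }
  where
  open import Relation.Binary.Reasoning.Setoid S.setoid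

  *-cong : ∀ {f f′ g g′} → f ≈ˢ f′ → g ≈ˢ g′ → f *ˢ g ≈ˢ f′ *ˢ g′
  *-cong {f} {f′} {g} {g′} p q = begin
    f *ˢ g    ≈⟨ *ˢ-⊛ f g ⟩
    f S.* g   ≈⟨ S.*-cong {f} {f′} {g} {g′} p q ⟩
    f′ S.* g′ ≈⟨ *ˢ-⊛ f′ g′ ⟨
    f′ *ˢ g′  ∎

  comm : ∀ f g → f *ˢ g ≈ˢ g *ˢ f
  comm f g = begin
    f *ˢ g  ≈⟨ *ˢ-⊛ f g ⟩
    f S.* g ≈⟨ S.*-comm f g ⟩
    g S.* f ≈⟨ *ˢ-⊛ g f ⟨
    g *ˢ f  ∎

  identityˡ : ∀ f → 𝟏 *ˢ f ≈ˢ f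
  identityˡ f = begin
    𝟏 *ˢ f     ≈⟨ *ˢ-⊛ 𝟏 f ⟩
    𝟏 S.* f    ≈⟨ S.*-congʳ {f} {𝟏} {S.1#} 𝟏-⊛ ⟩
    S.1# S.* f ≈⟨ S.*-identityˡ f ⟩
    f          ∎

  distribʳ : ∀ h f g → (f +ˢ g) *ˢ h ≈ˢ f *ˢ h +ˢ g *ˢ h
  distribʳ h f g = begin
    (f +ˢ g) *ˢ h         ≈⟨ *ˢ-⊛ (f +ˢ g) h ⟩
    (f +ˢ g) S.* h        ≈⟨ S.distribʳ h f g ⟩
    f S.* h +ˢ g S.* h    ≈⟨ S.+-cong {f *ˢ h} {f S.* h} {g *ˢ h} {g S.* h} (*ˢ-⊛ f h) (*ˢ-⊛ g h) ⟨
    f *ˢ h +ˢ g *ˢ h      ∎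

private module 𝓢 = CommutativeRing seriesRing

X-⊛ : X ≈ˢ ℚ[xyz].shift (ℚ[xyz].constant (CommutativeRing.1# ℚ[yz].commutativeRing))
X-⊛ zero          _       _       = refl
X-⊛ 1             zero    zero    = refl
X-⊛ 1             zero    (suc _) = refl
X-⊛ 1             (suc _) _       = refl
X-⊛ (suc (suc _)) _       _       = refl

Y-⊛ : Y ≈ˢ ℚ[xyz].constant (ℚ[yz].shift (ℚ[yz].constant (CommutativeRing.1# ℚ[z].commutativeRing)))
Y-⊛ zero    zero          _       = refl
Y-⊛ zero    1             zero    = refl
Y-⊛ zero    1             (suc _) = refl
Y-⊛ zero    (suc (suc _)) _       = refl
Y-⊛ (suc _) _             _       = refl

Z-⊛ : Z ≈ˢ ℚ[xyz].constant (ℚ[yz].constant (ℚ[z].shift (ℚ[z].constant 1ℚ)))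
Z-⊛ zero    zero    zero          = refl
Z-⊛ zero    zero    1             = refl
Z-⊛ zero    zero    (suc (suc _)) = refl
Z-⊛ zero    (suc _) _             = refl
Z-⊛ (suc _) _       _             = refl

X-* : ∀ f k l m → (X *ˢ f) k l m ≡ ℚ[xyz].shift f k l m
X-* f k l m = begin
  (X *ˢ f) k l m       ≡⟨ *ˢ-⊛ X f k l m ⟩
  (X ℚ[xyz].⊛ f) k l m ≡⟨ S.*-congʳ {f} {X} X-⊛ k l m ⟩
  _                    ≡⟨ ℚ[xyz].variable-⊛ f k l m ⟩
  ℚ[xyz].shift f k l m ∎
  where open ≡.≡-Reasoning

Y-* : ∀ f k l m → (Y *ˢ f) k l m ≡ ℚ[yz].shift (f k) l m
Y-* f k l m = begin
  (Y *ˢ f) k l m          ≡⟨ *ˢ-⊛ Y f k l m ⟩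
  (Y ℚ[xyz].⊛ f) k l m    ≡⟨ S.*-congʳ {f} {Y} Y-⊛ k l m ⟩
  _                       ≡⟨ ℚ[xyz].constant-⊛ _ f k l m ⟩
  _                       ≡⟨ ℚ[yz].variable-⊛ (f k) l m ⟩
  ℚ[yz].shift (f k) l m   ∎
  where open ≡.≡-Reasoning

Z-* : ∀ f k l m → (Z *ˢ f) k l m ≡ ℚ[z].shift (f k l) m
Z-* f k l m = begin
  (Z *ˢ f) k l m          ≡⟨ *ˢ-⊛ Z f k l m ⟩
  (Z ℚ[xyz].⊛ f) k l m    ≡⟨ S.*-congʳ {f} {Z} Z-⊛ k l m ⟩
  _                       ≡⟨ ℚ[xyz].constant-⊛ _ f k l m ⟩
  _                       ≡⟨ ℚ[yz].constant-⊛ _ (f k) l m ⟩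
  _                       ≡⟨ ℚ[z].variable-⊛ (f k l) m ⟩
  ℚ[z].shift (f k l) m    ∎
  where open ≡.≡-Reasoning

-- The series f₀(x,z) and (f - f₀)/y.
y⁰ Δ : Series → Series
y⁰ f k zero    m = f k 0 m
y⁰ f k (suc _) m = 0ℚ
Δ f k l m = f k (suc l) m

y-split : ∀ f → f ≈ˢ y⁰ f +ˢ Y *ˢ Δ f
y-split f k zero    m = sym (trans (cong (f k 0 m ℚ.+_) (Y-* (Δ f) k 0 m)) (ℚ.+-identityʳ _))
y-split f k (suc l) m = sym (trans (ℚ.+-identityˡ _) (Y-* (Δ f) k (suc l) m))

YFree : Series → Set
YFree f = ∀ k l m → f k (suc l) m ≡ 0ℚ

-- Multiplication by a y-free series works on each power of y separately, so it commutes with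
-- lowering the power.
Δ-* : ∀ f → YFree f → ∀ g → Δ (f *ˢ g) ≈ˢ f *ˢ Δ g
Δ-* f yf g k l m = begin
  (f *ˢ g) k (suc l) m          ≡⟨ *ˢ-⊛ f g k (suc l) m ⟩
  (f ℚ[xyz].⊛ g) k (suc l) m    ≡⟨ ⊛-Δ f yf k ⟩
  (f ℚ[xyz].⊛ Δ g) k l m        ≡⟨ *ˢ-⊛ f (Δ g) k l m ⟨
  (f *ˢ Δ g) k l m              ∎
  where
  open ≡.≡-Reasoning

  slice : ∀ f k → YFree f → (f 0 ℚ[yz].⊛ g k) (suc l) m ≡ (f 0 ℚ[yz].⊛ Δ g k) l m
  slice f k yf = trans
    (ℚ[yz].⊛-constantˡ (f 0) (g k) (yf 0) (suc l) m)
    (sym (ℚ[yz].⊛-constantˡ (f 0) (Δ g k) (yf 0) l m))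

  ⊛-Δ : ∀ f → YFree f → ∀ k → (f ℚ[xyz].⊛ g) k (suc l) m ≡ (f ℚ[xyz].⊛ Δ g) k l m
  ⊛-Δ f yf zero    = slice f 0 yf
  ⊛-Δ f yf (suc k) = cong₂ ℚ._+_ (slice f (suc k) yf) (⊛-Δ (λ a → f (suc a)) (λ a → yf (suc a)) k)

YFree-* : ∀ f g → YFree f → YFree g → YFree (f *ˢ g)
YFree-* f g yf yg k l m = begin
  (f *ˢ g) k (suc l) m ≡⟨ Δ-* f yf g k l m ⟩
  (f *ˢ Δ g) k l m     ≡⟨ 𝓢.*-congˡ {f} yg k l m ⟩
  (f *ˢ _) k l m       ≡⟨ 𝓢.zeroʳ f k l m ⟩
  0ℚ                   ∎
  where open ≡.≡-Reasoning

YFree-sub : ∀ f g → YFree f → YFree g → YFree (f -ˢ g)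
YFree-sub f g yf yg k l m = cong₂ ℚ._-_ (yf k l m) (yg k l m)

YFree-𝟏 : YFree 𝟏
YFree-𝟏 zero    _ _ = refl
YFree-𝟏 (suc _) _ _ = refl

YFree-𝟐 : YFree 𝟐
YFree-𝟐 zero    _ _ = refl
YFree-𝟐 (suc _) _ _ = refl

YFree-X : YFree X
YFree-X zero          _ _ = refl
YFree-X 1             _ _ = refl
YFree-X (suc (suc _)) _ _ = refl

YFree-Z : YFree Z
YFree-Z zero    _ _ = refl
YFree-Z (suc _) _ _ = refl

YFree-y⁰ : ∀ f → YFree (y⁰ f)
YFree-y⁰ f k l m = refl

-- Coefficients without y vanish because of the factor `Y`, the others because `f` is y-free.
YFree-multiple : ∀ f g → YFree f → f ≈ˢ Y *ˢ g → f ≈ˢ CommutativeRing.0# seriesRing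
YFree-multiple f g yf p k zero    m = trans (p k 0 m) (Y-* g k 0 m)
YFree-multiple f g yf p k (suc l) m = yf k l m

-- The recurrence f(k,l+1,m) = f(k,l,m) + f(k-1,l+1,m) + f(k,l+1,m-1) + f(k-1,l+2,m-1),
-- with f = 0 at negative arguments.
Recurrence : Series → Set
Recurrence f = Δ f ≈ˢ f +ˢ X *ˢ Δ f +ˢ Z *ˢ Δ f +ˢ X *ˢ (Z *ˢ Δ (Δ f))

recurrence-shifts : ∀ f k l m →
  (f +ˢ X *ˢ Δ f +ˢ Z *ˢ Δ f +ˢ X *ˢ (Z *ˢ Δ (Δ f))) k l m
  ≡ f k l m ℚ.+ ℚ[xyz].shift (Δ f) k l m ℚ.+ ℚ[z].shift (Δ f k l) m
    ℚ.+ ℚ[xyz].shift (λ k l → ℚ[z].shift (Δ (Δ f) k l)) k l m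
recurrence-shifts f k l m = cong₂ ℚ._+_
  (cong₂ ℚ._+_ (cong (f k l m ℚ.+_) (X-* (Δ f) k l m)) (Z-* (Δ f) k l m))
  (trans (𝓢.*-congˡ {X} (Z-* (Δ (Δ f))) k l m) (X-* _ k l m))

-- By linearity this is uniqueness of the solution with a given y-free part. The index of y rises
-- only in the term where those of x and z both fall, so the recursion terminates.
recurrence-zero : ∀ f → Recurrence f → (∀ k m → f k 0 m ≡ 0ℚ) → ∀ k l m → f k l m ≡ 0ℚ
recurrence-zero f rec f₀ k l m = go k l m
  where
  step : ∀ {k l m a b c d} → f k l m ≡ a → ℚ[xyz].shift (Δ f) k l m ≡ b → ℚ[z].shift (Δ f k l) m ≡ c →
    ℚ[xyz].shift (λ k l → ℚ[z].shift (Δ (Δ f) k l)) k l m ≡ d → f k (suc l) m ≡ a ℚ.+ b ℚ.+ c ℚ.+ d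
  step {k} {l} {m} refl refl refl refl = trans (rec k l m) (recurrence-shifts f k l m)

  go : ∀ k l m → f k l m ≡ 0ℚ
  go k       zero    m       = f₀ k m
  go zero    (suc l) zero    = step (go 0 l 0) refl refl refl
  go zero    (suc l) (suc m) = step (go 0 l (suc m)) refl (go 0 (suc l) m) refl
  go (suc k) (suc l) zero    = step (go (suc k) l 0) (go k (suc l) 0) refl refl
  go (suc k) (suc l) (suc m) =
    step (go (suc k) l (suc m)) (go k (suc l) (suc m)) (go (suc k) (suc l) m) (go k (suc (suc l)) m)

-- Fractions in `ℚ` are kept in lowest terms, so additivity does not compute and is checked on
-- unnormalised fractions.
/1-homo-+ : ∀ a b → + (a ℕ.+ b) ℚ./ 1 ≡ + a ℚ./ 1 ℚ.+ + b ℚ./ 1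
/1-homo-+ a b = ℚ.toℚᵘ-injective (begin
  ℚ.toℚᵘ (ℚ.fromℚᵘ (mkℚᵘ (+ (a ℕ.+ b)) 0))         ≈⟨ ℚ.toℚᵘ-fromℚᵘ _ ⟩
  mkℚᵘ (+ (a ℕ.+ b)) 0                             ≈⟨ *≡* (solve 2 (λ a b → (a :+ b) :* con (+ 1) := (a :* con (+ 1) :+ b :* con (+ 1)) :* con (+ 1)) refl (+ a) (+ b)) ⟩
  mkℚᵘ (+ a) 0 ℚᵘ.+ mkℚᵘ (+ b) 0                   ≈⟨ ℚᵘ.+-cong (ℚ.toℚᵘ-fromℚᵘ (mkℚᵘ (+ a) 0)) (ℚ.toℚᵘ-fromℚᵘ (mkℚᵘ (+ b) 0)) ⟨
  ℚ.toℚᵘ (+ a ℚ./ 1) ℚᵘ.+ ℚ.toℚᵘ (+ b ℚ./ 1)       ≈⟨ ℚ.toℚᵘ-homo-+ (+ a ℚ./ 1) (+ b ℚ./ 1) ⟨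
  ℚ.toℚᵘ (+ a ℚ./ 1 ℚ.+ + b ℚ./ 1)                 ∎)
  where
  open ℚᵘ.≃-Reasoning
  open +-*-Solver

G : Series
G = generatingFunction V

G-recurrence : Recurrence G
G-recurrence k l m = trans (shifts k l m) (sym (recurrence-shifts G k l m))
  where
  a+0+0+0 : ∀ a → a ≡ a ℚ.+ 0ℚ ℚ.+ 0ℚ ℚ.+ 0ℚ
  a+0+0+0 a = sym (trans (ℚ.+-identityʳ _) (trans (ℚ.+-identityʳ _) (ℚ.+-identityʳ a)))

  shifts : ∀ k l m → G k (suc l) m
    ≡ G k l m ℚ.+ ℚ[xyz].shift (Δ G) k l m ℚ.+ ℚ[z].shift (Δ G k l) m
      ℚ.+ ℚ[xyz].shift (λ k l → ℚ[z].shift (Δ (Δ G) k l)) k l m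
  shifts zero    l zero    = a+0+0+0 _
  shifts zero    l (suc m) = trans (/1-homo-+ (V 0 l (suc m)) _)
    (trans (cong (ℚ._+ G 0 (suc l) m) (sym (ℚ.+-identityʳ (G 0 l (suc m))))) (sym (ℚ.+-identityʳ _)))
  shifts (suc k) l zero    = trans (/1-homo-+ (V (suc k) l 0) _)
    (sym (trans (ℚ.+-identityʳ _) (ℚ.+-identityʳ _)))
  shifts (suc k) l (suc m) = trans (/1-homo-+ (V (suc k) l (suc m) ℕ.+ V k (suc l) (suc m) ℕ.+ V (suc k) (suc l) m) _)
    (cong (ℚ._+ G k (suc (suc l)) m) (trans (/1-homo-+ (V (suc k) l (suc m) ℕ.+ V k (suc l) (suc m)) _)
      (cong (ℚ._+ G (suc k) (suc l) m) (/1-homo-+ (V (suc k) l (suc m)) _))))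

G₀-recurrence : y⁰ G ≈ˢ 𝟏 +ˢ X *ˢ y⁰ G +ˢ Z *ˢ y⁰ G
G₀-recurrence k l m = trans (shifts k l m)
  (sym (cong₂ ℚ._+_ (cong (𝟏 k l m ℚ.+_) (X-* (y⁰ G) k l m)) (Z-* (y⁰ G) k l m)))
  where
  shifts : ∀ k l m → y⁰ G k l m ≡ 𝟏 k l m ℚ.+ ℚ[xyz].shift (y⁰ G) k l m ℚ.+ ℚ[z].shift (y⁰ G k l) m
  shifts zero    zero    zero    = refl
  shifts zero    zero    (suc m) = sym (ℚ.+-identityˡ _)
  shifts (suc k) zero    zero    = sym (trans (ℚ.+-identityʳ _) (ℚ.+-identityˡ _))
  shifts (suc k) zero    (suc m) = trans (/1-homo-+ (V k 0 (suc m)) _)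
    (cong (ℚ._+ G (suc k) 0 m) (sym (ℚ.+-identityˡ (G k 0 (suc m)))))
  shifts zero    (suc l) zero    = refl
  shifts zero    (suc l) (suc m) = refl
  shifts (suc k) (suc l) zero    = refl
  shifts (suc k) (suc l) (suc m) = refl

-- The ratio of consecutive coefficients of y, and the closed form

open KernelMethod seriesRing

-- Since `A` inverts `G₀`, the series `T` is G₁/G₀, the only candidate for a constant ratio between
-- consecutive coefficients of the powers of y.
A G₀ G₁ T : Series
A  = 𝟏 -ˢ X -ˢ Z
G₀ = y⁰ G
G₁ = y⁰ (Δ G)
T  = A *ˢ G₁

YFree-A : YFree A
YFree-A = YFree-sub (𝟏 -ˢ X) Z (YFree-sub 𝟏 X YFree-𝟏 YFree-X) YFree-Z

YFree-T : YFree T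
YFree-T = YFree-* A G₁ YFree-A (YFree-y⁰ (Δ G))

AG₀≈1 : A *ˢ G₀ ≈ˢ 𝟏
AG₀≈1 = inverse X Y Z G₀ G₀-recurrence

Δ-cong : ∀ {f g} → f ≈ˢ g → Δ f ≈ˢ Δ g
Δ-cong p k l m = p k (suc l) m

-- The coefficients of the recurrence involve only X and Z, which `Δ` passes through.
ΔG-recurrence : Recurrence (Δ G)
ΔG-recurrence k l m = begin
  Δ (Δ G) k l m
    ≡⟨ G-recurrence k (suc l) m ⟩
  (G +ˢ X *ˢ Δ G +ˢ Z *ˢ Δ G +ˢ X *ˢ (Z *ˢ Δ (Δ G))) k (suc l) m
    ≡⟨ cong₂ ℚ._+_ (cong₂ ℚ._+_ (cong (G k (suc l) m ℚ.+_)
         (Δ-* X YFree-X (Δ G) k l m)) (Δ-* Z YFree-Z (Δ G) k l m))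
         (trans (Δ-* X YFree-X (Z *ˢ Δ (Δ G)) k l m)
                (𝓢.*-congˡ {X} (Δ-* Z YFree-Z (Δ (Δ G))) k l m)) ⟩
  (Δ G +ˢ X *ˢ Δ (Δ G) +ˢ Z *ˢ Δ (Δ G) +ˢ X *ˢ (Z *ˢ Δ (Δ (Δ G)))) k l m ∎
  where open ≡.≡-Reasoning

-- Its vanishing is the equality Gₗ₊₁ = T Gₗ for all l at once.
defect : Series
defect = T *ˢ G -ˢ Δ G

defect-Δ : ∀ f g → Δ (T *ˢ f -ˢ g) ≈ˢ T *ˢ Δ f -ˢ Δ g
defect-Δ f g = 𝓢.+-congʳ { 𝓢.- Δ g } (Δ-* T YFree-T f)

defect-recurrent : Recurrence defect
defect-recurrent = defect-recurrence X Y Z T G (Δ G) (Δ (Δ G)) (Δ (Δ (Δ G))) {defect} {Δ defect} {Δ (Δ defect)}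
  (𝓢.refl {defect}) (defect-Δ G (Δ G)) (λ k l m → trans (defect-Δ G (Δ G) k (suc l) m) (defect-Δ (Δ G) (Δ (Δ G)) k l m))
  G-recurrence ΔG-recurrence

defect≈0 : ∀ k l m → defect k l m ≡ 0ℚ
defect≈0 = recurrence-zero defect defect-recurrent
  (λ k m → trans (defect-multiple X Y Z G G₀ G₁ (Δ G) (Δ (Δ G)) (y-split G) (y-split (Δ G)) AG₀≈1 k 0 m)
                 (Y-* (T *ˢ Δ G -ˢ Δ (Δ G)) k 0 m))

open import Algebra.Properties.Ring 𝓢.ring using (x∙y⁻¹≈ε⇒x≈y)

TG≈ΔG : T *ˢ G ≈ˢ Δ G
TG≈ΔG = x∙y⁻¹≈ε⇒x≈y (T *ˢ G) (Δ G) defect≈0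

TΔG≈ΔΔG : T *ˢ Δ G ≈ˢ Δ (Δ G)
TΔG≈ΔΔG = 𝓢.trans (𝓢.sym (Δ-* T YFree-T G)) (Δ-cong TG≈ΔG)

T-quadratic : quadratic X Y Z T ≈ˢ 𝓢.0#
T-quadratic = quadratic-root X Y Z T G₀ AG₀≈1
  (YFree-multiple (quadratic X Y Z T *ˢ G₀) (𝓢.- (quadratic X Y Z T *ˢ Δ G))
    (YFree-* (quadratic X Y Z T) G₀
      (YFree-sub (A *ˢ T -ˢ 𝟏) (X *ˢ Z *ˢ (T *ˢ T))
        (YFree-sub (A *ˢ T) 𝟏 (YFree-* A T YFree-A YFree-T) YFree-𝟏)
        (YFree-* (X *ˢ Z) (T *ˢ T) (YFree-* X Z YFree-X YFree-Z) (YFree-* T T YFree-T YFree-T)))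
      (YFree-y⁰ G))
    (quadratic-multiple X Y Z T G G₀ (Δ G) (Δ (Δ G)) (y-split G) G-recurrence TG≈ΔG TΔG≈ΔΔG))

𝟐≈𝟏+𝟏 : 𝟐 ≈ˢ 𝟏 +ˢ 𝟏
𝟐≈𝟏+𝟏 zero    zero    zero    = refl
𝟐≈𝟏+𝟏 zero    zero    (suc _) = refl
𝟐≈𝟏+𝟏 zero    (suc _) _       = refl
𝟐≈𝟏+𝟏 (suc _) _       _       = refl

√ : Series
√ = root X Y Z 𝟐 𝟐≈𝟏+𝟏 T

√-isSquareRoot : IsSquareRoot √ (𝟏 -ˢ 𝟐 *ˢ (X +ˢ Z) +ˢ (X -ˢ Z) *ˢ (X -ˢ Z))
√-isSquareRoot =
    YFree-sub A (𝟐 *ˢ X *ˢ Z *ˢ T) YFree-A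
      (YFree-* (𝟐 *ˢ X *ˢ Z) T (YFree-* (𝟐 *ˢ X) Z (YFree-* 𝟐 X YFree-𝟐 YFree-X) YFree-Z) YFree-T)
  , refl
  , root² X Y Z 𝟐 𝟐≈𝟏+𝟏 T T-quadratic

denominator : Series
denominator = 𝟐 *ˢ (𝟏 -ˢ X -ˢ Z) *ˢ ((X +ˢ Y) *ˢ (Y +ˢ Z) -ˢ Y)

denominator≉𝟎 : ¬ (denominator ≈ˢ 𝟎)
-- The coefficient of y in the denominator is -2.
denominator≉𝟎 p with () ← p 0 1 0

G-closedForm : G ≈ 𝟐 *ˢ X *ˢ Z -ˢ Y *ˢ (𝟏 -ˢ X -ˢ Z) -ˢ Y *ˢ √ /ˢ denominator
G-closedForm = denominator≉𝟎 , functional-equation X Y Z 𝟐 𝟐≈𝟏+𝟏 G G₀ G₁ (Δ G) (Δ (Δ G))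
  (y-split G) (y-split (Δ G)) G-recurrence AG₀≈1

-- Vertices of GZ(1^k 2^l 3^m)

length-123 : ∀ k l m → length (1^ k 2^ l 3^ m) ≡ k ℕ.+ l ℕ.+ m
length-123 k l m = begin
  length (1^ k 2^ l 3^ m)
    ≡⟨ length-++ (replicate k (+ 1)) ⟩
  length (replicate k (+ 1)) ℕ.+ length (replicate l (+ 2) ++ replicate m (+ 3))
    ≡⟨ cong₂ ℕ._+_ (length-replicate k) (length-++ (replicate l (+ 2))) ⟩
  k ℕ.+ (length (replicate l (+ 2)) ℕ.+ length (replicate m (+ 3)))
    ≡⟨ cong (k ℕ.+_) (cong₂ ℕ._+_ (length-replicate l) (length-replicate m)) ⟩
  k ℕ.+ (l ℕ.+ m)
    ≡⟨ ℕ.+-assoc k l m ⟨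
  k ℕ.+ l ℕ.+ m ∎
  where open ≡.≡-Reasoning

lookup-123 : ∀ k l m i → lookup (1^ k 2^ l 3^ m) i ≡ row k l (toℕ i)
lookup-123 (suc k) l       m       zero    = refl
lookup-123 (suc k) l       m       (suc i) = lookup-123 k l m i
lookup-123 zero    (suc l) m       zero    = refl
lookup-123 zero    (suc l) m       (suc i) = lookup-123 zero l m i
lookup-123 zero    zero    (suc m) zero    = refl
lookup-123 zero    zero    (suc m) (suc i) = lookup-123 zero zero m i

module _ {c ℓ₁ ℓ₂ ℓ₃} (K : OrderedField c ℓ₁ ℓ₂ ℓ₃) where

  open OrderedField K using (fromℤ; _≈_)
  open OrderedFieldProperties K using (≈-refl; ≈-sym)
  open Patterns K
  open Vertices K
  open E

  module _ (p : List ℤ) where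

    topRow : Row (length p)
    topRow j h = fromℤ (lookup p (fromℕ< h))

    -- The case distinction on the row number only lets `entry` and `entryᴿ` reduce; the
    -- inequalities themselves are the same.
    InGZ⇒∈GZ : ∀ {u} → InGZ topRow u → _∈GZ K p u
    InGZ⇒∈GZ g zero    j h = g zero j h
    InGZ⇒∈GZ g (suc i) j h = g (suc i) j h

    ∈GZ⇒InGZ : ∀ {u} → _∈GZ K p u → InGZ topRow u
    ∈GZ⇒InGZ g zero    j h = g zero j h
    ∈GZ⇒InGZ g (suc i) j h = g (suc i) j h

    Extreme⇒IsVertex : ∀ {v} → Extreme topRow v → IsVertex K p v
    Extreme⇒IsVertex (g , e) = InGZ⇒∈GZ g , λ u w t gu gw → e u w t (∈GZ⇒InGZ gu) (∈GZ⇒InGZ gw)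

    IsVertex⇒Extreme : ∀ {v} → IsVertex K p v → Extreme topRow v
    IsVertex⇒Extreme (g , e) = ∈GZ⇒InGZ g , λ u w t gu gw → e u w t (InGZ⇒∈GZ gu) (InGZ⇒∈GZ gw)

    vertexCount : ∀ {N} → Enumeration {length p} (Extreme topRow) N → HasVertexCount K p N
    vertexCount E = record
      { to        = λ i → element i , Extreme⇒IsVertex (satisfies i)
      ; cong      = λ { refl _ _ _ → ≈-refl }
      ; bijective = injective , λ (v , isVertex) →
          let i , eᵢ≈v = surjective v (IsVertex⇒Extreme isVertex)
          in i , λ { refl → eᵢ≈v }
      }
      where open Enumeration E

  topRow≈top : ∀ k l m → topRow (1^ k 2^ l 3^ m) ≈ᴿ top k l
  topRow≈top k l m j h = subst (λ z → fromℤ (lookup (1^ k 2^ l 3^ m) (fromℕ< h)) ≈ fromℤ z)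
    (trans (lookup-123 k l m (fromℕ< h)) (cong (row k l) (toℕ-fromℕ< h))) ≈-refl

  V-counts : ∀ k l m → HasVertexCount K (1^ k 2^ l 3^ m) (V k l m)
  V-counts k l m = vertexCount (1^ k 2^ l 3^ m) (relabel
    (Extreme-resp (λ j h → ≈-sym (topRow≈top k l m j h)) (λ _ _ _ → ≈-refl))
    (Extreme-resp (topRow≈top k l m) (λ _ _ _ → ≈-refl))
    (enumerate (length (1^ k 2^ l 3^ m)) k l m (length-123 k l m)))

theorem1p3 : ∀ {c ℓ₁ ℓ₂ ℓ₃} (K : OrderedField c ℓ₁ ℓ₂ ℓ₃) →
    Σ (ℕ → ℕ → ℕ → ℕ) λ V → Σ Series λ √ →
    (∀ k l m → HasVertexCount K (1^ k 2^ l 3^ m) (V k l m))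
    × IsSquareRoot √ (𝟏 -ˢ 𝟐 *ˢ (X +ˢ Z) +ˢ (X -ˢ Z) *ˢ (X -ˢ Z))
    × (generatingFunction V
    ≈ 𝟐 *ˢ X *ˢ Z -ˢ Y *ˢ (𝟏 -ˢ X -ˢ Z) -ˢ Y *ˢ √
    /ˢ 𝟐 *ˢ (𝟏 -ˢ X -ˢ Z) *ˢ ((X +ˢ Y) *ˢ (Y +ˢ Z) -ˢ Y))
theorem1p3 K = V , √ , V-counts K , √-isSquareRoot , G-closedForm
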